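{- Let $\bar S$ be an Assmus–Mattson Steiner triple system of order $N\ge 99$. Then $\bar S$ admits a zero-sum $5$-flow, i.e. there is a vector $v$ indexed by the blocks of $\bar S$, with all entries in $\{\pm1,\pm2,\pm3,\pm4\}$, such that $\sum_{T\in\bar S,\ x\in T} v_T=0$ for every point $x$ of $\bar S$.
   Context: A Steiner triple system (STS) of order $n$ is a collection $S$ of $3$-subsets (blocks) of $\{1,\dots,n\}$ such that every $2$-subset lies in exactly one block. Assmus–Mattson construction: given an STS $S$ of order $n$ on $\{1,\dots,n\}$ and a function $\tau:S\to\{0,1\}$, take the point set $\{1,\dots,n,\bar1,\dots,\bar n,2n+1\}$ (where $\bar i$ denotes $i+n$). For each block $\{i,j,k\}\in S$ with $\tau(\{i,j,k\})=0$ include the four blocks $\{i,j,k\},\{i,\bar j,\bar k\},\{\bar i,j,\bar k\},\{\bar i,\bar j,k\}$; for each block with $\tau(\{i,j,k\})=1$ include the four blocks $\{\bar i,j,k\},\{\bar i,\bar j,\bar k\},\{i,j,\bar k\},\{i,\bar j,k\}$; finally include the blocks $\{i,\bar i,2n+1\}$ for $i=1,\dots,n$. The result $\bar S$ is an STS of order $N=2n+1$, called an Assmus–Mattson STS. -}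

module Defs where

open import Data.Nat using (ℕ; suc; _+_; _≤_)
open import Data.Fin using (Fin; zero; suc; _↑ˡ_; _↑ʳ_)
open import Data.Fin.Properties using () renaming (_≟_ to _≟F_)
open import Data.Bool using (Bool; true; false; _∧_; _∨_; if_then_else_)
open import Data.Product using (_×_; _,_; ∃)
open import Data.List using (List; []; _∷_; _++_; map; concatMap; length; lookup; allFin)
open import Data.List.Membership.Propositional using (_∈_)
open import Data.Integer using (ℤ; ∣_∣) renaming (_+_ to _+ℤ_; 0ℤ to 0ℤ)
open import Relation.Binary.PropositionalEquality using (_≡_; _≢_)
open import Relation.Nullary.Decidable using (⌊_⌋)

-- A block (3-subset) on the point set Fin n, given by its three elements.
Block : ℕ → Set
Block n = Fin n × Fin n × Fin n

_∈B_ : ∀ {n} → Fin n → Block n → Bool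
x ∈B (a , b , c) = ⌊ x ≟F a ⌋ ∨ ⌊ x ≟F b ⌋ ∨ ⌊ x ≟F c ⌋

count : ∀ {A : Set} → (A → Bool) → List A → ℕ
count p [] = 0
count p (a ∷ as) = if p a then suc (count p as) else count p as

Distinct3 : ∀ {n} → Block n → Set
Distinct3 (a , b , c) = a ≢ b × a ≢ c × b ≢ c

-- S (a list of blocks) is a Steiner triple system of order n: every block is a
-- 3-subset and every 2-subset {x,y} lies in exactly one block of the list
-- (in particular no block is listed twice).
IsSTS : (n : ℕ) → List (Block n) → Set
IsSTS n S =
  (∀ B → B ∈ S → Distinct3 B) ×
  (∀ (x y : Fin n) → x ≢ y → count (λ B → x ∈B B ∧ y ∈B B) S ≡ 1)

-- Points of the Assmus–Mattson system: Fin (suc (n + n)).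
-- The point 2n+1 is represented by zero, i by plain i, and ī by bar i.
∞pt : ∀ {n} → Fin (suc (n + n))
∞pt = zero

plain : ∀ {n} → Fin n → Fin (suc (n + n))
plain {n} i = suc (i ↑ˡ n)

bar : ∀ {n} → Fin n → Fin (suc (n + n))
bar {n} i = suc (n ↑ʳ i)

amGen : ∀ {n} → Bool → Block n → List (Block (suc (n + n)))
amGen false (i , j , k) =
  (plain i , plain j , plain k) ∷ (plain i , bar j , bar k) ∷
  (bar i , plain j , bar k) ∷ (bar i , bar j , plain k) ∷ []
amGen true (i , j , k) =
  (bar i , plain j , plain k) ∷ (bar i , bar j , bar k) ∷
  (plain i , plain j , bar k) ∷ (plain i , bar j , plain k) ∷ []

-- The Assmus–Mattson STS S̄ of order 2n+1 from S and τ : S → {0,1}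
-- (τ given on the blocks of S via their positions in the list; false = 0, true = 1).
assmusMattson : (n : ℕ) (S : List (Block n)) → (Fin (length S) → Bool) →
                List (Block (suc (n + n)))
assmusMattson n S τ =
  concatMap (λ t → amGen (τ t) (lookup S t)) (allFin (length S)) ++
  map (λ i → (plain i , bar i , ∞pt {n})) (allFin n)

sumℤ : List ℤ → ℤ
sumℤ [] = 0ℤ
sumℤ (z ∷ zs) = z +ℤ sumℤ zs

ZeroSum5Flow : (N : ℕ) → List (Block N) → Set
ZeroSum5Flow N T =
  ∃ λ (v : Fin (length T) → ℤ) →
    (∀ t → 1 ≤ ∣ v t ∣ × ∣ v t ∣ ≤ 4) ×
    (∀ (x : Fin N) →
      sumℤ (map (λ t → if x ∈B lookup T t then v t else 0ℤ) (allFin (length T))) ≡ 0ℤ)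

{-# OPTIONS --safe #-}

-- Give a block t = {i,j,k} of S a symmetric weight s and skew weights a, b, c for its three points,
-- and its four lifts the weights s+a+b+c, s+a-b-c, s-a+b-c, s-a-b+c (with a negated if τ(t) = 1).
-- Then t contributes 2(s+a) to the sum at i and 2(s-a) to the sum at ī, and similarly for j and k.
-- So it suffices that at each point the skew weights cancel and the block {i,ī,2n+1} compensates the
-- symmetric ones. With skew weights in {0,±1}, nonzero lifts only restrict the absolute values,
-- so cancellation at a point just needs an even number of nonzero skew weights there.
--
-- Generic blocks get s = 0 and three nonzero skew weights. The blocks through a fixed point o meet
-- every other point exactly once; giving them s = ±1, ±2, and one further block t⋆ = {x,y,z} s = -1,
-- makes the total of s at every point ±1 or ±2. As Σ s = 0 the sum at 2n+1 vanishes. The parity of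
-- the replication number (n-1)/2 decides whether blocks through o also carry skew weights.
module Submission where

open import Defs
open import Algebra.Properties.Semiring.Sum as Sum using ()
open import Data.Bool using (Bool; true; false; if_then_else_; _∧_; not; T)
import Data.Bool.Properties as Bool
open import Data.Fin using (Fin; zero; suc; splitAt)
open import Data.Fin.Properties
  using (_≟_; suc-injective; ↑ˡ-injective; ↑ʳ-injective; splitAt-↑ˡ; splitAt-↑ʳ; splitAt⁻¹-↑ˡ; splitAt⁻¹-↑ʳ)
open import Data.Integer as ℤ using (ℤ; +_; -[1+_]; 0ℤ; 1ℤ; -1ℤ; ∣_∣; _+_; _-_; _*_; -_)
import Data.Integer.Properties as ℤ
open import Data.Integer.Tactic.RingSolver using (solve-∀)
open import Data.List using (List; []; _∷_; _++_; map; concatMap; length; lookup; allFin; tabulate)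
open import Data.List.Membership.Propositional using (_∈_)
open import Data.List.Membership.Propositional.Properties using (∈-lookup)
open import Data.List.Properties using (map-tabulate; map-++; map-∘; map-concatMap; concatMap-cong)
open import Data.List.Relation.Unary.All as All using (All; []; _∷_)
import Data.List.Relation.Unary.All.Properties as All
open import Data.List.Relation.Unary.Any using (here; there)
open import Data.Nat as ℕ using (ℕ; zero; suc; _≤_; _≤?_; z≤n; s≤s)
import Data.Nat.Properties as ℕ
open import Data.Product using (_×_; _,_; ∃-syntax; proj₁; proj₂)
open import Data.Sum using (_⊎_; inj₁; inj₂; [_,_]′; map₂; swap)
open import Data.Unit using (tt)
open import Function using (_∘_; id)
open import Relation.Binary.PropositionalEquality
open import Relation.Nullary using (¬_; Dec; yes; no; contradiction)
open import Relation.Nullary.Decidable using (⌊_⌋; _×-dec_; _→-dec_; from-yes; from-no; T?)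

open Sum ℤ.+-*-semiring
  using () renaming (sum to ∑; sum-cong-≗ to ∑-cong; ∑-distrib-+ to ∑-+; ∑-comm to ∑-swap; *-distribˡ-sum to *-∑)

private variable
  n N m : ℕ

-- Weighted lists of blocks and their net flow.

Nowhere-zero : ℤ → Set
Nowhere-zero w = 1 ≤ ∣ w ∣ × ∣ w ∣ ≤ 4

netflow : Fin N → List (Block N × ℤ) → ℤ
netflow x []            = 0ℤ
netflow x ((B , w) ∷ W) = (if x ∈B B then w else 0ℤ) + netflow x W

netflow-++ : ∀ (x : Fin N) V W → netflow x (V ++ W) ≡ netflow x V + netflow x W
netflow-++ x []            W = sym (ℤ.+-identityˡ _)
netflow-++ x ((B , w) ∷ V) W rewrite netflow-++ x V W =
  sym (ℤ.+-assoc (if x ∈B B then w else 0ℤ) _ _)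

netflow-concatMap : ∀ (x : Fin N) (g : Fin m → List (Block N × ℤ)) {l} (f : Fin l → Fin m) →
  netflow x (concatMap g (tabulate f)) ≡ ∑ (netflow x ∘ g ∘ f)
netflow-concatMap x g {zero}  f = refl
netflow-concatMap x g {suc l} f = trans (netflow-++ x (g (f zero)) _)
  (cong (λ z → netflow x (g (f zero)) + z) (netflow-concatMap x g (f ∘ suc)))

netflow-map : ∀ (x : Fin N) (g : Fin m → Block N × ℤ) {l} (f : Fin l → Fin m) →
  netflow x (map g (tabulate f)) ≡
  ∑ (λ i → if x ∈B proj₁ (g (f i)) then proj₂ (g (f i)) else 0ℤ)
netflow-map x g {zero}  f = refl
netflow-map x g {suc l} f =
  cong (λ z → (if x ∈B proj₁ (g (f zero)) then proj₂ (g (f zero)) else 0ℤ) + z) (netflow-map x g (f ∘ suc))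

sumℤ-tabulate : (f : Fin m → ℤ) → sumℤ (tabulate f) ≡ ∑ f
sumℤ-tabulate {zero}  f = refl
sumℤ-tabulate {suc m} f = cong (λ z → f zero + z) (sumℤ-tabulate (f ∘ suc))

-- Indexing by `map proj₁ W` makes this a weight function on the bare list of blocks, in the form
-- that `ZeroSum5Flow` asks for.
weight : (W : List (Block N × ℤ)) → Fin (length (map proj₁ W)) → ℤ
weight ((_ , w) ∷ W) zero    = w
weight (_       ∷ W) (suc t) = weight W t

weight-nowhere-zero : ∀ {W : List (Block N × ℤ)} → All (Nowhere-zero ∘ proj₂) W →
  ∀ t → Nowhere-zero (weight W t)
weight-nowhere-zero (p ∷ _)  zero    = p
weight-nowhere-zero (_ ∷ ps) (suc t) = weight-nowhere-zero ps t

∑-weight : ∀ (x : Fin N) W →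
  ∑ (λ t → if x ∈B lookup (map proj₁ W) t then weight W t else 0ℤ) ≡ netflow x W
∑-weight x []            = refl
∑-weight x ((B , w) ∷ W) = cong (λ z → (if x ∈B B then w else 0ℤ) + z) (∑-weight x W)

weights⇒flow : (W : List (Block N × ℤ)) → All (Nowhere-zero ∘ proj₂) W →
  (∀ x → netflow x W ≡ 0ℤ) → ZeroSum5Flow N (map proj₁ W)
weights⇒flow W nz bal = weight W , weight-nowhere-zero nz , λ x →
  trans (cong sumℤ (map-tabulate id (λ t → if x ∈B lookup (map proj₁ W) t then weight W t else 0ℤ)))
  (trans (sumℤ-tabulate (λ t → if x ∈B lookup (map proj₁ W) t then weight W t else 0ℤ)) (trans (∑-weight x W) (bal x)))

-- The four lifts of one block and their net flow.

gadgetWeights : Bool → (s a b c : ℤ) → ℤ × ℤ × ℤ × ℤ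
gadgetWeights false s a b c = s + a + b + c , s + a - b - c , s - a + b - c , s - a - b + c
-- Interchanging i and ī carries the blocks of `amGen false` to those of `amGen true` in order.
-- Negating `a` thus keeps the rule that a plain point adds its skew weight and a barred point
-- subtracts it.
gadgetWeights true  s a b c = gadgetWeights false s (- a) b c

gadget : Bool → Block n → ℤ → (Fin n → ℤ) → List (Block (suc (n ℕ.+ n)) × ℤ)
gadget τ (i , j , k) s p with gadgetWeights τ s (p i) (p j) (p k)
gadget false (i , j , k) s p | w₁ , w₂ , w₃ , w₄ =
  ((plain i , plain j , plain k) , w₁) ∷ ((plain i , bar j , bar k) , w₂) ∷
  ((bar i , plain j , bar k) , w₃) ∷ ((bar i , bar j , plain k) , w₄) ∷ []
gadget true (i , j , k) s p | w₁ , w₂ , w₃ , w₄ =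
  ((bar i , plain j , plain k) , w₁) ∷ ((bar i , bar j , bar k) , w₂) ∷
  ((plain i , plain j , bar k) , w₃) ∷ ((plain i , bar j , plain k) , w₄) ∷ []

gadget-blocks : ∀ τ (B : Block n) s p → map proj₁ (gadget τ B s p) ≡ amGen τ B
gadget-blocks false B s p = refl
gadget-blocks true  B s p = refl

bool-⇔ : ∀ {A B : Set} (a? : Dec A) (b? : Dec B) → (A → B) → (B → A) → ⌊ a? ⌋ ≡ ⌊ b? ⌋
bool-⇔ (yes a) (yes b) f g = refl
bool-⇔ (yes a) (no ¬b) f g = contradiction (f a) ¬b
bool-⇔ (no ¬a) (yes b) f g = contradiction (g b) ¬a
bool-⇔ (no ¬a) (no ¬b) f g = refl

⌊⌋-false : ∀ {A : Set} (a? : Dec A) → ¬ A → ⌊ a? ⌋ ≡ false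
⌊⌋-false (yes a) ¬a = contradiction a ¬a
⌊⌋-false (no _)  _  = refl

⌊⌋-true : ∀ {A : Set} (a? : Dec A) → A → ⌊ a? ⌋ ≡ true
⌊⌋-true (yes a) _ = refl
⌊⌋-true (no ¬a) a = contradiction a ¬a

plain≢bar : (i j : Fin n) → plain i ≢ bar j
plain≢bar {n} i j eq with () ← trans (sym (splitAt-↑ˡ n i n))
  (trans (cong (splitAt n) (suc-injective eq)) (splitAt-↑ʳ n n j))

plain-plain : (u i : Fin n) → ⌊ plain u ≟ plain i ⌋ ≡ ⌊ u ≟ i ⌋
plain-plain {n} u i = bool-⇔ _ _ (↑ˡ-injective n u i ∘ suc-injective) (cong plain)

bar-bar : (u i : Fin n) → ⌊ bar u ≟ bar i ⌋ ≡ ⌊ u ≟ i ⌋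
bar-bar {n} u i = bool-⇔ _ _ (↑ʳ-injective n u i ∘ suc-injective) (cong bar)

plain-bar : (u i : Fin n) → ⌊ plain u ≟ bar i ⌋ ≡ false
plain-bar u i = ⌊⌋-false _ (plain≢bar u i)

bar-plain : (u i : Fin n) → ⌊ bar u ≟ plain i ⌋ ≡ false
bar-plain u i = ⌊⌋-false _ (plain≢bar i u ∘ sym)

netflow-gadget-∞ : ∀ τ (B : Block n) s p → netflow (∞pt {n}) (gadget τ B s p) ≡ 0ℤ
netflow-gadget-∞ false B s p = refl
netflow-gadget-∞ true  B s p = refl

-- A plain point of the block lies on two of the lifts. There the skew weights of the other two
-- points have opposite signs and cancel.
netflow-gadget-plain : ∀ τ (B : Block n) s p u → Distinct3 B →
  netflow (plain u) (gadget τ B s p) ≡ (if u ∈B B then + 2 * (s + p u) else 0ℤ)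
netflow-gadget-plain false (i , j , k) s p u (i≢j , i≢k , j≢k)
  rewrite plain-plain u i | plain-plain u j | plain-plain u k
        | plain-bar u i | plain-bar u j | plain-bar u k
  with u ≟ i | u ≟ j | u ≟ k
... | yes refl | yes u≡j  | _        = contradiction u≡j i≢j
... | yes refl | no _     | yes u≡k  = contradiction u≡k i≢k
... | no _     | yes refl | yes u≡k  = contradiction u≡k j≢k
... | yes refl | no _     | no _     = identity s (p i) (p j) (p k)
  where
  identity : ∀ s a b c → s + a + b + c + (s + a - b - c + (0ℤ + (0ℤ + 0ℤ))) ≡ + 2 * (s + a)
  identity = solve-∀
... | no _     | yes refl | no _     = identity s (p i) (p j) (p k)
  where
  identity : ∀ s a b c → s + a + b + c + (0ℤ + (s - a + b - c + (0ℤ + 0ℤ))) ≡ + 2 * (s + b)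
  identity = solve-∀
... | no _     | no _     | yes refl = identity s (p i) (p j) (p k)
  where
  identity : ∀ s a b c → s + a + b + c + (0ℤ + (0ℤ + (s - a - b + c + 0ℤ))) ≡ + 2 * (s + c)
  identity = solve-∀
... | no _     | no _     | no _     = refl
netflow-gadget-plain true (i , j , k) s p u (i≢j , i≢k , j≢k)
  rewrite plain-plain u i | plain-plain u j | plain-plain u k
        | plain-bar u i | plain-bar u j | plain-bar u k
  with u ≟ i | u ≟ j | u ≟ k
... | yes refl | yes u≡j  | _        = contradiction u≡j i≢j
... | yes refl | no _     | yes u≡k  = contradiction u≡k i≢k
... | no _     | yes refl | yes u≡k  = contradiction u≡k j≢k
... | yes refl | no _     | no _     = identity s (p i) (p j) (p k)
  where
  identity : ∀ s a b c → 0ℤ + (0ℤ + (s - - a + b - c + (s - - a - b + c + 0ℤ))) ≡ + 2 * (s + a)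
  identity = solve-∀
... | no _     | yes refl | no _     = identity s (p i) (p j) (p k)
  where
  identity : ∀ s a b c → s + - a + b + c + (0ℤ + (s - - a + b - c + (0ℤ + 0ℤ))) ≡ + 2 * (s + b)
  identity = solve-∀
... | no _     | no _     | yes refl = identity s (p i) (p j) (p k)
  where
  identity : ∀ s a b c → s + - a + b + c + (0ℤ + (0ℤ + (s - - a - b + c + 0ℤ))) ≡ + 2 * (s + c)
  identity = solve-∀
... | no _     | no _     | no _     = refl

-- The barred point lies on the two complementary lifts, where `p u` is subtracted and the other
-- skew weights again cancel.
netflow-gadget-bar : ∀ τ (B : Block n) s p u → Distinct3 B →
  netflow (bar u) (gadget τ B s p) ≡ (if u ∈B B then + 2 * (s - p u) else 0ℤ)
netflow-gadget-bar false (i , j , k) s p u (i≢j , i≢k , j≢k)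
  rewrite bar-bar u i | bar-bar u j | bar-bar u k
        | bar-plain u i | bar-plain u j | bar-plain u k
  with u ≟ i | u ≟ j | u ≟ k
... | yes refl | yes u≡j  | _        = contradiction u≡j i≢j
... | yes refl | no _     | yes u≡k  = contradiction u≡k i≢k
... | no _     | yes refl | yes u≡k  = contradiction u≡k j≢k
... | yes refl | no _     | no _     = identity s (p i) (p j) (p k)
  where
  identity : ∀ s a b c → 0ℤ + (0ℤ + (s - a + b - c + (s - a - b + c + 0ℤ))) ≡ + 2 * (s - a)
  identity = solve-∀
... | no _     | yes refl | no _     = identity s (p i) (p j) (p k)
  where
  identity : ∀ s a b c → 0ℤ + (s + a - b - c + (0ℤ + (s - a - b + c + 0ℤ))) ≡ + 2 * (s - b)
  identity = solve-∀
... | no _     | no _     | yes refl = identity s (p i) (p j) (p k)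
  where
  identity : ∀ s a b c → 0ℤ + (s + a - b - c + (s - a + b - c + (0ℤ + 0ℤ))) ≡ + 2 * (s - c)
  identity = solve-∀
... | no _     | no _     | no _     = refl
netflow-gadget-bar true (i , j , k) s p u (i≢j , i≢k , j≢k)
  rewrite bar-bar u i | bar-bar u j | bar-bar u k
        | bar-plain u i | bar-plain u j | bar-plain u k
  with u ≟ i | u ≟ j | u ≟ k
... | yes refl | yes u≡j  | _        = contradiction u≡j i≢j
... | yes refl | no _     | yes u≡k  = contradiction u≡k i≢k
... | no _     | yes refl | yes u≡k  = contradiction u≡k j≢k
... | yes refl | no _     | no _     = identity s (p i) (p j) (p k)
  where
  identity : ∀ s a b c → s + - a + b + c + (s + - a - b - c + (0ℤ + (0ℤ + 0ℤ))) ≡ + 2 * (s - a)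
  identity = solve-∀
... | no _     | yes refl | no _     = identity s (p i) (p j) (p k)
  where
  identity : ∀ s a b c → 0ℤ + (s + - a - b - c + (0ℤ + (s - - a - b + c + 0ℤ))) ≡ + 2 * (s - b)
  identity = solve-∀
... | no _     | no _     | yes refl = identity s (p i) (p j) (p k)
  where
  identity : ∀ s a b c → 0ℤ + (s + - a - b - c + (s - - a + b - c + (0ℤ + 0ℤ))) ≡ + 2 * (s - c)
  identity = solve-∀
... | no _     | no _     | no _     = refl

-- Finite sums, counting and choice of signs.

⟦_⟧ : Bool → ℕ
⟦ true ⟧  = 1
⟦ false ⟧ = 0

∑-zero : (f : Fin m → ℤ) → (∀ t → f t ≡ 0ℤ) → ∑ f ≡ 0ℤ
∑-zero {zero}  f f≡0 = refl
∑-zero {suc m} f f≡0 = cong₂ _+_ (f≡0 zero) (∑-zero (f ∘ suc) (f≡0 ∘ suc))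

∑-one : ∀ m → ∑ {m} (λ _ → 1ℤ) ≡ + m
∑-one zero    = refl
∑-one (suc m) = cong (λ z → 1ℤ + z) (∑-one m)

∑-supported : (a : Fin m) (f : Fin m → ℤ) → (∀ t → t ≢ a → f t ≡ 0ℤ) → ∑ f ≡ f a
∑-supported zero    f z =
  trans (cong (λ y → f zero + y) (∑-zero (f ∘ suc) λ t → z (suc t) λ ())) (ℤ.+-identityʳ _)
∑-supported (suc a) f z =
  trans (cong₂ _+_ (z zero λ ()) (∑-supported a (f ∘ suc) λ t t≢a → z (suc t) (t≢a ∘ suc-injective)))
  (ℤ.+-identityˡ _)

point : Fin m → ℤ → Fin m → ℤ
point a x t = if ⌊ t ≟ a ⌋ then x else 0ℤ

point-≡ : ∀ (a : Fin m) x → point a x a ≡ x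
point-≡ a x rewrite ⌊⌋-true (a ≟ a) refl = refl

point-≢ : ∀ {a t : Fin m} x → t ≢ a → point a x t ≡ 0ℤ
point-≢ {a = a} {t} x t≢a rewrite ⌊⌋-false (t ≟ a) t≢a = refl

∑-point : ∀ (a : Fin m) x → ∑ (point a x) ≡ x
∑-point a x = trans (∑-supported a (point a x) (λ t → point-≢ x)) (point-≡ a x)

∑-supported₂ : (a b : Fin m) (f : Fin m → ℤ) → a ≢ b → (∀ t → t ≢ a → t ≢ b → f t ≡ 0ℤ) →
  ∑ f ≡ f a + f b
∑-supported₂ a b f a≢b z = trans (∑-cong split) (trans (∑-+ (point a (f a)) (point b (f b)))
  (cong₂ _+_ (∑-point a (f a)) (∑-point b (f b))))
  where
  split : ∀ t → f t ≡ point a (f a) t + point b (f b) t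
  split t with t ≟ a | t ≟ b
  ... | yes refl | yes refl = contradiction refl a≢b
  ... | yes refl | no _     = sym (ℤ.+-identityʳ _)
  ... | no _     | yes refl = sym (ℤ.+-identityˡ _)
  ... | no t≢a   | no t≢b   = z t t≢a t≢b

# : (Fin m → Bool) → ℕ
# {zero}  P = 0
# {suc m} P = ⟦ P zero ⟧ ℕ.+ # (P ∘ suc)

#-cong : {P Q : Fin m → Bool} → (∀ t → P t ≡ Q t) → # P ≡ # Q
#-cong {zero}  P≗Q = refl
#-cong {suc m} P≗Q = cong₂ (λ b k → ⟦ b ⟧ ℕ.+ k) (P≗Q zero) (#-cong (P≗Q ∘ suc))

∑-# : (P : Fin m → Bool) → ∑ (λ t → if P t then 1ℤ else 0ℤ) ≡ + # P
∑-# {zero}  P = refl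
∑-# {suc m} P with P zero
... | true  = cong (λ z → 1ℤ + z) (∑-# (P ∘ suc))
... | false = trans (ℤ.+-identityˡ _) (∑-# (P ∘ suc))

count≡# : ∀ {A : Set} (p : A → Bool) as → count p as ≡ # (p ∘ lookup as)
count≡# p []       = refl
count≡# p (a ∷ as) with p a
... | true  = cong suc (count≡# p as)
... | false = count≡# p as

#≡0 : {P : Fin m → Bool} → # P ≡ 0 → ∀ t → P t ≢ true
#≡0 {suc m} {P} e t p with P zero in q
#≡0 {suc m} {P} e zero    p | false with () ← trans (sym p) q
#≡0 {suc m} {P} e (suc t) p | false = #≡0 e t p

#≡1 : {P : Fin m → Bool} → # P ≡ 1 → ∃[ t ] P t ≡ true × (∀ t′ → P t′ ≡ true → t′ ≡ t)
#≡1 {suc m} {P} e with P zero in q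
... | true  = zero , q , λ where
  zero    _ → refl
  (suc t) p → contradiction p (#≡0 (ℕ.suc-injective e) t)
... | false with #≡1 {P = P ∘ suc} e
...   | t , p , unique = suc t , p , λ where
  zero     p′ → contradiction (trans (sym p′) q) λ ()
  (suc t′) p′ → cong suc (unique t′ p′)

_∖_ : (Fin m → Bool) → Fin m → Fin m → Bool
(P ∖ a) t = P t ∧ not ⌊ t ≟ a ⌋

∖-≢ : (P : Fin m → Bool) {a t : Fin m} → t ≢ a → (P ∖ a) t ≡ P t
∖-≢ P {a} {t} t≢a rewrite ⌊⌋-false (t ≟ a) t≢a = Bool.∧-identityʳ (P t)

∖-≡ : (P : Fin m → Bool) {a t : Fin m} → t ≡ a → (P ∖ a) t ≡ false
∖-≡ P {a} refl rewrite ⌊⌋-true (a ≟ a) refl = Bool.∧-zeroʳ (P a)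

#-∖ : (P : Fin m → Bool) (a : Fin m) → P a ≡ true → # P ≡ suc (# (P ∖ a))
#-∖ {suc m} P zero    p rewrite p = cong suc (#-cong {Q = (P ∖ zero) ∘ suc} λ t → sym (Bool.∧-identityʳ (P (suc t))))
#-∖ {suc m} P (suc a) p =
  trans (cong₂ (λ b k → ⟦ b ⟧ ℕ.+ k) (sym (Bool.∧-identityʳ (P zero))) (#-∖ (P ∘ suc) a p))
  (trans (ℕ.+-suc ⟦ P zero ∧ true ⟧ _)
  (cong (λ k → suc (⟦ P zero ∧ true ⟧ ℕ.+ k)) (#-cong λ t → cong (λ b → P (suc t) ∧ not b)
    (bool-⇔ (t ≟ a) (suc t ≟ suc a) (cong suc) suc-injective))))

-- The first `p` indices satisfying `P` receive 1, the other `q` receive -1. Equal `p` and `q` give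
-- cancelling skew weights; unequal ones give the symmetric weights of the free blocks.
signing : (P : Fin m → Bool) (p q : ℕ) → # P ≡ p ℕ.+ q →
  ∃[ f ] (∀ t → ∣ f t ∣ ≡ ⟦ P t ⟧) × ∑ f ≡ + p - + q
signing {zero}  P zero zero e = (λ ()) , (λ ()) , refl
signing {suc m} P p q e with P zero in P₀
signing {suc m} P p q e | false with signing (P ∘ suc) p q e
... | f , ∣f∣ , ∑f = (λ { zero → 0ℤ ; (suc t) → f t }) , (λ { zero → cong ⟦_⟧ (sym P₀) ; (suc t) → ∣f∣ t }) ,
  trans (ℤ.+-identityˡ _) ∑f
signing {suc m} P (suc p) q e | true with signing (P ∘ suc) p q (ℕ.suc-injective e)
... | f , ∣f∣ , ∑f = (λ { zero → 1ℤ ; (suc t) → f t }) , (λ { zero → cong ⟦_⟧ (sym P₀) ; (suc t) → ∣f∣ t }) ,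
  trans (cong (λ z → 1ℤ + z) ∑f) (lem (+ p) (+ q))
  where
  lem : ∀ a b → 1ℤ + (a - b) ≡ (1ℤ + a) - b
  lem = solve-∀
signing {suc m} P zero (suc q) e | true with signing (P ∘ suc) 0 q (ℕ.suc-injective e)
... | f , ∣f∣ , ∑f = (λ { zero → -1ℤ ; (suc t) → f t }) , (λ { zero → cong ⟦_⟧ (sym P₀) ; (suc t) → ∣f∣ t }) ,
  trans (cong (λ z → -1ℤ + z) ∑f) (lem (+ q))
  where
  lem : ∀ b → -1ℤ + (0ℤ - b) ≡ 0ℤ - (1ℤ + b)
  lem = solve-∀

-- Admissible weights.

-- The pairs (∣ s ∣ , number of nonzero skew weights) for which no choice of signs makes a lift
-- vanish or exceed 4.
admissible : ℕ → ℕ → Bool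
admissible 0 3 = true
admissible 1 0 = true
admissible 1 2 = true
admissible 2 0 = true
admissible 2 1 = true
admissible _ _ = false

AllNowhere-zero : ℤ × ℤ × ℤ × ℤ → Set
AllNowhere-zero (w₁ , w₂ , w₃ , w₄) = Nowhere-zero w₁ × Nowhere-zero w₂ × Nowhere-zero w₃ × Nowhere-zero w₄

trits : List ℤ
trits = -1ℤ ∷ 0ℤ ∷ 1ℤ ∷ []

∈-trits : ∀ z → ∣ z ∣ ≤ 1 → z ∈ trits
∈-trits (+ 0)       _ = there (here refl)
∈-trits (+ 1)       _ = there (there (here refl))
∈-trits (+ suc (suc _)) (s≤s ())
∈-trits (-[1+ 0 ])  _ = here refl
∈-trits (-[1+ suc _ ]) (s≤s ())

quints : List ℤ
quints = -[1+ 1 ] ∷ -1ℤ ∷ 0ℤ ∷ 1ℤ ∷ + 2 ∷ []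

∈-quints : ∀ z k → T (admissible ∣ z ∣ k) → z ∈ quints
∈-quints (+ 0)                 _ _ = there (there (here refl))
∈-quints (+ 1)                 _ _ = there (there (there (here refl)))
∈-quints (+ 2)                 _ _ = there (there (there (there (here refl))))
∈-quints (+ suc (suc (suc _))) _ ()
∈-quints (-[1+ 0 ])            _ _ = there (here refl)
∈-quints (-[1+ 1 ])            _ _ = here refl
∈-quints (-[1+ suc (suc _) ])  _ ()

nowhere-zero? : ∀ w → Dec (Nowhere-zero w)
nowhere-zero? w = (1 ≤? ∣ w ∣) ×-dec (∣ w ∣ ≤? 4)

allNowhere-zero? : ∀ ws → Dec (AllNowhere-zero ws)
allNowhere-zero? (w₁ , w₂ , w₃ , w₄) =
  nowhere-zero? w₁ ×-dec nowhere-zero? w₂ ×-dec nowhere-zero? w₃ ×-dec nowhere-zero? w₄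

-- Evaluated over all 5 · 27 tuples. Conceptually: with no skew weights every lift equals `s`; in
-- the other admissible pairs the two entries add up to 3, so every lift is odd and at most 3 in
-- absolute value.
admissible-check : All (λ s → All (λ a → All (λ b → All (λ c →
    T (admissible ∣ s ∣ (∣ a ∣ ℕ.+ ∣ b ∣ ℕ.+ ∣ c ∣)) → AllNowhere-zero (gadgetWeights false s a b c))
  trits) trits) trits) quints
admissible-check = from-yes (All.all? (λ s → All.all? (λ a → All.all? (λ b → All.all? (λ c →
  T? (admissible ∣ s ∣ (∣ a ∣ ℕ.+ ∣ b ∣ ℕ.+ ∣ c ∣)) →-dec allNowhere-zero? (gadgetWeights false s a b c)) trits) trits) trits) quints)

gadgetWeights-nowhere-zero : ∀ τ s a b c → ∣ a ∣ ≤ 1 → ∣ b ∣ ≤ 1 → ∣ c ∣ ≤ 1 →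
  T (admissible ∣ s ∣ (∣ a ∣ ℕ.+ ∣ b ∣ ℕ.+ ∣ c ∣)) → AllNowhere-zero (gadgetWeights τ s a b c)
gadgetWeights-nowhere-zero false s a b c a≤ b≤ c≤ adm =
  All.lookup (All.lookup (All.lookup (All.lookup admissible-check
    (∈-quints s _ adm)) (∈-trits a a≤)) (∈-trits b b≤)) (∈-trits c c≤) adm
-- Admissibility sees only absolute values, so the case `false` applies to `- a`.
gadgetWeights-nowhere-zero true s a b c a≤ b≤ c≤ adm =
  gadgetWeights-nowhere-zero false s (- a) b c (subst (_≤ 1) ∣a∣ a≤) b≤ c≤
    (subst (λ k → T (admissible ∣ s ∣ (k ℕ.+ ∣ b ∣ ℕ.+ ∣ c ∣))) ∣a∣ adm)
  where
  ∣a∣ : ∣ a ∣ ≡ ∣ - a ∣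
  ∣a∣ = sym (ℤ.∣-i∣≡∣i∣ a)

gadget-nowhere-zero : ∀ τ {i j k : Fin n} s p → (∀ u → ∣ p u ∣ ≤ 1) →
  T (admissible ∣ s ∣ (∣ p i ∣ ℕ.+ ∣ p j ∣ ℕ.+ ∣ p k ∣)) →
  All (Nowhere-zero ∘ proj₂) (gadget τ (i , j , k) s p)
gadget-nowhere-zero τ {i} {j} {k} s p p≤1 adm
  with τ | gadgetWeights-nowhere-zero τ s (p i) (p j) (p k) (p≤1 i) (p≤1 j) (p≤1 k) adm
... | false | nz₁ , nz₂ , nz₃ , nz₄ = nz₁ ∷ nz₂ ∷ nz₃ ∷ nz₄ ∷ []
... | true  | nz₁ , nz₂ , nz₃ , nz₄ = nz₁ ∷ nz₂ ∷ nz₃ ∷ nz₄ ∷ []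

-- From block weights to a flow on the Assmus-Mattson system.

∑-block : ∀ (B : Block n) x → Distinct3 B → ∑ (λ u → if u ∈B B then x else 0ℤ) ≡ + 3 * x
∑-block (i , j , k) x (i≢j , i≢k , j≢k) = trans (∑-cong split) (trans (∑-+ _ (point k x))
  (trans (cong₂ _+_ (trans (∑-+ (point i x) (point j x)) (cong₂ _+_ (∑-point i x) (∑-point j x))) (∑-point k x)) (triple x)))
  where
  triple : ∀ x → x + x + x ≡ + 3 * x
  triple = solve-∀
  split : ∀ u → (if u ∈B (i , j , k) then x else 0ℤ) ≡ point i x u + point j x u + point k x u
  split u with u ≟ i | u ≟ j | u ≟ k
  ... | yes refl | yes u≡j  | _        = contradiction u≡j i≢j
  ... | yes refl | no _     | yes u≡k  = contradiction u≡k i≢k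
  ... | no _     | yes refl | yes u≡k  = contradiction u≡k j≢k
  ... | yes refl | no _     | no _     = sym (trans (ℤ.+-identityʳ _) (ℤ.+-identityʳ _))
  ... | no _     | yes refl | no _     = sym (trans (ℤ.+-identityʳ _) (ℤ.+-identityˡ _))
  ... | no _     | no _     | yes refl = sym (ℤ.+-identityˡ _)
  ... | no _     | no _     | no _     = refl

pointView : (x : Fin (suc (n ℕ.+ n))) → x ≡ ∞pt {n} ⊎ (∃[ u ] x ≡ plain {n} u) ⊎ (∃[ u ] x ≡ bar {n} u)
pointView zero        = inj₁ refl
pointView {n} (suc y) with splitAt n y in e
... | inj₁ u = inj₂ (inj₁ (u , cong suc (sym (splitAt⁻¹-↑ˡ e))))
... | inj₂ u = inj₂ (inj₂ (u , cong suc (sym (splitAt⁻¹-↑ʳ e))))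

module _ (S : List (Block n)) where

  inc : Fin n → Fin (length S) → Bool
  inc u t = u ∈B lookup S t

  load : (Fin (length S) → ℤ) → Fin n → ℤ
  load s u = ∑ (λ t → if inc u t then s t else 0ℤ)

  -- Exchange of summation: each block is counted once from each of its three points.
  ∑-load : (∀ B → B ∈ S → Distinct3 B) → ∀ s → ∑ (load s) ≡ + 3 * ∑ s
  ∑-load distinct s = trans (∑-swap (λ u t → if inc u t then s t else 0ℤ))
    (trans (∑-cong λ t → ∑-block (lookup S t) (s t) (distinct _ (∈-lookup t)))
    (sym (*-∑ (+ 3) s)))

  module _ (distinct : ∀ B → B ∈ S → Distinct3 B) (τ : Fin (length S) → Bool)
    (s : Fin (length S) → ℤ) (p : Fin n → Fin (length S) → ℤ) where

    -- Once the skew weights at i cancel, the lifts contribute the same amount at i and at ī, so one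
    -- weight on {i, ī, ∞} balances both points.
    stalk : Fin n → Block (suc (n ℕ.+ n)) × ℤ
    stalk i = (plain i , bar i , ∞pt {n}) , - (+ 2 * load s i)

    lift : Fin (length S) → List (Block (suc (n ℕ.+ n)) × ℤ)
    lift t = gadget (τ t) (lookup S t) (s t) (λ u → p u t)

    liftedWeights : List (Block (suc (n ℕ.+ n)) × ℤ)
    liftedWeights = concatMap lift (allFin (length S)) ++ map stalk (allFin n)

    liftedWeights-blocks : map proj₁ liftedWeights ≡ assmusMattson n S τ
    liftedWeights-blocks = trans (map-++ proj₁ (concatMap lift (allFin (length S))) (map stalk (allFin n)))
      (cong₂ _++_ (trans (map-concatMap proj₁ lift (allFin (length S)))
                         (concatMap-cong (λ t → gadget-blocks (τ t) (lookup S t) (s t) (λ u → p u t)) (allFin (length S))))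
                  (sym (map-∘ (allFin n))))

    netflow-lifted : ∀ x → netflow x liftedWeights ≡
      ∑ (λ t → netflow x (lift t)) + ∑ (λ i → if x ∈B proj₁ (stalk i) then proj₂ (stalk i) else 0ℤ)
    netflow-lifted x = trans (netflow-++ x (concatMap lift (allFin (length S))) (map stalk (allFin n)))
      (cong₂ _+_ (netflow-concatMap x lift id) (netflow-map x stalk id))

    stalk-plain : ∀ u → ∑ (λ i → if plain u ∈B proj₁ (stalk i) then proj₂ (stalk i) else 0ℤ) ≡ - (+ 2 * load s u)
    stalk-plain u = trans (∑-supported u _ λ i i≢u → at i (⌊⌋-false (u ≟ i) (i≢u ∘ sym))) (at u (⌊⌋-true (u ≟ u) refl))
      where
      at : ∀ i {b} → ⌊ u ≟ i ⌋ ≡ b → (if plain u ∈B proj₁ (stalk i) then proj₂ (stalk i) else 0ℤ) ≡ (if b then proj₂ (stalk i) else 0ℤ)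
      at i {b} e rewrite plain-plain u i | plain-bar u i | e with b
      ... | true  = refl
      ... | false = refl

    stalk-bar : ∀ u → ∑ (λ i → if bar u ∈B proj₁ (stalk i) then proj₂ (stalk i) else 0ℤ) ≡ - (+ 2 * load s u)
    stalk-bar u = trans (∑-supported u _ λ i i≢u → at i (⌊⌋-false (u ≟ i) (i≢u ∘ sym))) (at u (⌊⌋-true (u ≟ u) refl))
      where
      at : ∀ i {b} → ⌊ u ≟ i ⌋ ≡ b → (if bar u ∈B proj₁ (stalk i) then proj₂ (stalk i) else 0ℤ) ≡ (if b then proj₂ (stalk i) else 0ℤ)
      at i {b} e rewrite bar-bar u i | bar-plain u i | e with b
      ... | true  = refl
      ... | false = refl

    distinct-at : ∀ t → Distinct3 (lookup S t)
    distinct-at t = distinct _ (∈-lookup t)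

    -- Used with `q` equal to `p u` at a plain point and to its negative at a barred one. As `q`
    -- vanishes on blocks missing `u`, restricting its sum to the blocks through `u` changes
    -- nothing.
    ∑-lift : ∀ u (q : Fin (length S) → ℤ) → (∀ t → inc u t ≡ false → q t ≡ 0ℤ) → ∑ q ≡ 0ℤ →
      ∑ (λ t → if inc u t then + 2 * (s t + q t) else 0ℤ) ≡ + 2 * load s u
    ∑-lift u q supp ∑q = begin
      ∑ (λ t → if inc u t then + 2 * (s t + q t) else 0ℤ)      ≡⟨ ∑-cong split ⟩
      ∑ (λ t → + 2 * ((if inc u t then s t else 0ℤ) + q t))    ≡⟨ *-∑ (+ 2) (λ t → (if inc u t then s t else 0ℤ) + q t) ⟨
      + 2 * ∑ (λ t → (if inc u t then s t else 0ℤ) + q t)      ≡⟨ cong (λ z → + 2 * z) (∑-+ (λ t → if inc u t then s t else 0ℤ) q) ⟩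
      + 2 * (load s u + ∑ q)                                    ≡⟨ cong (λ z → + 2 * (load s u + z)) ∑q ⟩
      + 2 * (load s u + 0ℤ)                                     ≡⟨ cong (λ z → + 2 * z) (ℤ.+-identityʳ _) ⟩
      + 2 * load s u                                            ∎
      where
      open ≡-Reasoning
      split : ∀ t → (if inc u t then + 2 * (s t + q t) else 0ℤ) ≡ + 2 * ((if inc u t then s t else 0ℤ) + q t)
      split t with inc u t in e
      ... | true  = refl
      ... | false rewrite supp t e = refl

    -- Admissibility controls the lifts, and the bounds on the load put each stalk weight between 2
    -- and 4 in absolute value. At ∞ only stalks contribute, with total -6 times the sum of `s`.
    lifted-flow : (∀ u t → ∣ p u t ∣ ≤ 1) → (∀ u t → inc u t ≡ false → p u t ≡ 0ℤ) → (∀ u → ∑ (p u) ≡ 0ℤ) →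
      (∀ t → let (i , j , k) = lookup S t in
             T (admissible ∣ s t ∣ (∣ p i t ∣ ℕ.+ ∣ p j t ∣ ℕ.+ ∣ p k t ∣))) →
      (∀ u → 1 ≤ ∣ load s u ∣ × ∣ load s u ∣ ≤ 2) → ∑ s ≡ 0ℤ →
      ZeroSum5Flow (suc (n ℕ.+ n)) (assmusMattson n S τ)
    lifted-flow p≤1 supp ∑p adm load-bounds ∑s =
      subst (ZeroSum5Flow (suc (n ℕ.+ n))) liftedWeights-blocks (weights⇒flow liftedWeights nz bal)
      where
      stalk-nz : ∀ i → Nowhere-zero (- (+ 2 * load s i))
      stalk-nz i with load-bounds i
      ... | 1≤ , ≤2 = subst (1 ≤_) (sym ∣stalk∣) (ℕ.≤-trans 1≤ (ℕ.m≤n*m ∣ load s i ∣ 2)) ,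
                      subst (_≤ 4) (sym ∣stalk∣) (ℕ.*-monoʳ-≤ 2 ≤2)
        where
        ∣stalk∣ : ∣ - (+ 2 * load s i) ∣ ≡ 2 ℕ.* ∣ load s i ∣
        ∣stalk∣ = trans (ℤ.∣-i∣≡∣i∣ (+ 2 * load s i)) (ℤ.abs-* (+ 2) (load s i))

      nz : All (Nowhere-zero ∘ proj₂) liftedWeights
      nz = All.++⁺
        (All.concat⁺ (All.map⁺ (All.tabulate⁺ λ t → gadget-nowhere-zero (τ t) (s t) (λ u → p u t) (λ u → p≤1 u t) (adm t))))
        (All.map⁺ (All.tabulate⁺ stalk-nz))

      bal : ∀ x → netflow x liftedWeights ≡ 0ℤ
      bal x with pointView {n} x
      ... | inj₁ refl = trans (netflow-lifted (∞pt {n})) (cong₂ _+_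
          (∑-zero (λ t → netflow (∞pt {n}) (lift t)) λ t → netflow-gadget-∞ (τ t) (lookup S t) (s t) (λ u → p u t))
          ∑stalk)
        where
        ∑stalk : ∑ (λ i → - (+ 2 * load s i)) ≡ 0ℤ
        ∑stalk = begin
          ∑ (λ i → - (+ 2 * load s i))       ≡⟨ ∑-cong (λ i → ℤ.neg-distribˡ-* (+ 2) (load s i)) ⟩
          ∑ (λ i → - (+ 2) * load s i)       ≡⟨ *-∑ (- (+ 2)) (load s) ⟨
          - (+ 2) * ∑ (load s)               ≡⟨ cong (λ z → - (+ 2) * z) (∑-load distinct s) ⟩
          - (+ 2) * (+ 3 * ∑ s)              ≡⟨ cong (λ z → - (+ 2) * (+ 3 * z)) ∑s ⟩
          0ℤ                                 ∎
          where open ≡-Reasoning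
      ... | inj₂ (inj₁ (u , refl)) = trans (netflow-lifted (plain u)) (trans (cong₂ _+_
          (trans (∑-cong λ t → netflow-gadget-plain (τ t) (lookup S t) (s t) (λ u → p u t) u (distinct-at t))
                 (∑-lift u (p u) (supp u) (∑p u)))
          (stalk-plain u))
          (ℤ.+-inverseʳ (+ 2 * load s u)))
      ... | inj₂ (inj₂ (u , refl)) = trans (netflow-lifted (bar u)) (trans (cong₂ _+_
          (trans (∑-cong λ t → netflow-gadget-bar (τ t) (lookup S t) (s t) (λ u → p u t) u (distinct-at t))
                 (∑-lift u (λ t → - p u t) (λ t e → cong -_ (supp u t e)) ∑-p))
          (stalk-bar u))
          (ℤ.+-inverseʳ (+ 2 * load s u)))
        where
        ∑-p : ∑ (λ t → - p u t) ≡ 0ℤ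
        ∑-p = trans (∑-cong λ t → sym (ℤ.-1*i≡-i (p u t))) (trans (sym (*-∑ -1ℤ (p u))) (cong (λ z → -1ℤ * z) (∑p u)))

-- Points of a single block.

T≢F : {b : Bool} → b ≡ true → b ≢ false
T≢F refl ()

∧-true : ∀ {a b} → a ∧ b ≡ true → a ≡ true × b ≡ true
∧-true {true} {true} _ = refl , refl

member₁ : (B : Block n) → proj₁ B ∈B B ≡ true
member₁ (i , j , k) rewrite ⌊⌋-true (i ≟ i) refl = refl

member₂ : (B : Block n) → proj₁ (proj₂ B) ∈B B ≡ true
member₂ (i , j , k) rewrite ⌊⌋-true (j ≟ j) refl = Bool.∨-zeroʳ ⌊ j ≟ i ⌋

member₃ : (B : Block n) → proj₂ (proj₂ B) ∈B B ≡ true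
member₃ (i , j , k) rewrite ⌊⌋-true (k ≟ k) refl | Bool.∨-zeroʳ ⌊ k ≟ j ⌋ = Bool.∨-zeroʳ ⌊ k ≟ i ⌋

∈B⇒≡ : ∀ u {i j k : Fin n} → u ∈B (i , j , k) ≡ true → u ≡ i ⊎ u ≡ j ⊎ u ≡ k
∈B⇒≡ u {i} {j} {k} u∈ with u ≟ i | u ≟ j | u ≟ k
... | yes u≡i | _       | _       = inj₁ u≡i
... | no _    | yes u≡j | _       = inj₂ (inj₁ u≡j)
... | no _    | no _    | yes u≡k = inj₂ (inj₂ u≡k)

third : (B : Block n) → Distinct3 B → ∀ {u v} → u ∈B B ≡ true → v ∈B B ≡ true → u ≢ v →
  ∃[ w ] w ∈B B ≡ true × w ≢ u × w ≢ v × (∀ p → p ∈B B ≡ true → p ≡ u ⊎ p ≡ v ⊎ p ≡ w)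
third B@(i , j , k) (i≢j , i≢k , j≢k) {u} {v} u∈ v∈ u≢v with ∈B⇒≡ u u∈ | ∈B⇒≡ v v∈
... | inj₁ refl        | inj₁ refl        = contradiction refl u≢v
... | inj₂ (inj₁ refl) | inj₂ (inj₁ refl) = contradiction refl u≢v
... | inj₂ (inj₂ refl) | inj₂ (inj₂ refl) = contradiction refl u≢v
... | inj₁ refl        | inj₂ (inj₁ refl) = k , member₃ B , i≢k ∘ sym , j≢k ∘ sym , λ p → ∈B⇒≡ p
... | inj₁ refl        | inj₂ (inj₂ refl) = j , member₂ B , i≢j ∘ sym , j≢k ,
  λ p p∈ → map₂ swap (∈B⇒≡ p p∈)
... | inj₂ (inj₁ refl) | inj₁ refl        = k , member₃ B , j≢k ∘ sym , i≢k ∘ sym ,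
  λ p p∈ → [ inj₂ ∘ inj₁ , [ inj₁ , inj₂ ∘ inj₂ ]′ ]′ (∈B⇒≡ p p∈)
... | inj₂ (inj₁ refl) | inj₂ (inj₂ refl) = i , member₁ B , i≢j , i≢k ,
  λ p p∈ → [ inj₂ ∘ inj₂ , [ inj₁ , inj₂ ∘ inj₁ ]′ ]′ (∈B⇒≡ p p∈)
... | inj₂ (inj₂ refl) | inj₁ refl        = j , member₂ B , j≢k , i≢j ∘ sym ,
  λ p p∈ → [ inj₂ ∘ inj₁ , [ inj₂ ∘ inj₂ , inj₁ ]′ ]′ (∈B⇒≡ p p∈)
... | inj₂ (inj₂ refl) | inj₂ (inj₁ refl) = i , member₁ B , i≢k , i≢j ,
  λ p p∈ → [ inj₂ ∘ inj₂ , [ inj₂ ∘ inj₁ , inj₁ ]′ ]′ (∈B⇒≡ p p∈)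

tally : (Fin n → Bool) → Block n → ℕ
tally g (i , j , k) = ⟦ g i ⟧ ℕ.+ ⟦ g j ⟧ ℕ.+ ⟦ g k ⟧

tally-cong : ∀ {g h : Fin n → Bool} (B : Block n) → (∀ u → u ∈B B ≡ true → g u ≡ h u) → tally g B ≡ tally h B
tally-cong B@(i , j , k) e
  rewrite e i (member₁ B) | e j (member₂ B) | e k (member₃ B) = refl

tally-point : ∀ (B : Block n) a → Distinct3 B → a ∈B B ≡ true →
  tally (λ u → ⌊ u ≟ a ⌋) B ≡ 1 × tally (λ u → not ⌊ u ≟ a ⌋) B ≡ 2
tally-point (i , j , k) a (i≢j , i≢k , j≢k) a∈ with ∈B⇒≡ a a∈
... | inj₁ refl rewrite ⌊⌋-true (i ≟ i) refl | ⌊⌋-false (j ≟ i) (i≢j ∘ sym) | ⌊⌋-false (k ≟ i) (i≢k ∘ sym) = refl , refl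
... | inj₂ (inj₁ refl) rewrite ⌊⌋-false (i ≟ j) i≢j | ⌊⌋-true (j ≟ j) refl | ⌊⌋-false (k ≟ j) (j≢k ∘ sym) = refl , refl
... | inj₂ (inj₂ refl) rewrite ⌊⌋-false (i ≟ k) i≢k | ⌊⌋-false (j ≟ k) j≢k | ⌊⌋-true (k ≟ k) refl = refl , refl

-- Incidence geometry of a Steiner triple system.

module Geometry (S : List (Block n)) (sts : IsSTS n S) where

  I : Fin n → Fin (length S) → Bool
  I = inc S

  distinct-blocks : ∀ t → Distinct3 (lookup S t)
  distinct-blocks t = proj₁ sts _ (∈-lookup t)

  #-pair : ∀ {u v} → u ≢ v → # (λ t → I u t ∧ I v t) ≡ 1
  #-pair {u} {v} u≢v = trans (sym (count≡# (λ B → u ∈B B ∧ v ∈B B) S)) (proj₂ sts u v u≢v)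

  line : ∀ {u v} → u ≢ v →
    ∃[ t ] I u t ≡ true × I v t ≡ true × (∀ t′ → I u t′ ≡ true → I v t′ ≡ true → t′ ≡ t)
  line u≢v with #≡1 (#-pair u≢v)
  ... | t , both , unique = t , proj₁ (∧-true both) , proj₂ (∧-true both) , λ t′ u∈ v∈ → unique t′ (cong₂ _∧_ u∈ v∈)

  meet-unique : ∀ {u v t t′} → u ≢ v → I u t ≡ true → I v t ≡ true → I u t′ ≡ true → I v t′ ≡ true → t ≡ t′
  meet-unique u≢v u∈t v∈t u∈t′ v∈t′ with line u≢v
  ... | _ , _ , _ , unique = trans (unique _ u∈t v∈t) (sym (unique _ u∈t′ v∈t′))

  -- Counts the pairs (y , t) with u and y both on t, once by blocks and once by points.
  degree : ∀ u → n ≡ suc (# (I u) ℕ.+ # (I u))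
  degree u = ℤ.+-injective (begin
    + n                                          ≡⟨ solve-n (+ n) (+ r) ⟩
    + n + (+ r - 1ℤ) - (+ r - 1ℤ)                ≡⟨ cong (λ z → z - (+ r - 1ℤ)) double-count ⟩
    + 3 * + r - (+ r - 1ℤ)                       ≡⟨ solve-r (+ r) ⟩
    + suc (r ℕ.+ r)                              ∎)
    where
    open ≡-Reasoning
    r = # (I u)
    σ : Fin (length S) → ℤ
    σ t = if I u t then 1ℤ else 0ℤ
    solve-n : ∀ n r → n ≡ n + (r - 1ℤ) - (r - 1ℤ)
    solve-n = solve-∀
    solve-r : ∀ r → + 3 * r - (r - 1ℤ) ≡ 1ℤ + (r + r)
    solve-r = solve-∀
    load-# : ∀ y → load S σ y ≡ + # (λ t → I y t ∧ I u t)
    load-# y = trans (∑-cong nest) (∑-# (λ t → I y t ∧ I u t))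
      where
      nest : ∀ t → (if I y t then σ t else 0ℤ) ≡ (if I y t ∧ I u t then 1ℤ else 0ℤ)
      nest t with I y t
      ... | true  = refl
      ... | false = refl
    load-σ : ∀ y → load S σ y ≡ 1ℤ + point u (+ r - 1ℤ) y
    load-σ y with y ≟ u
    ... | yes refl = trans (load-# u) (trans (cong +_ (#-cong λ t → Bool.∧-idem (I u t))) (step (+ r)))
      where
      step : ∀ r → r ≡ 1ℤ + (r - 1ℤ)
      step = solve-∀
    ... | no y≢u   = trans (load-# y) (cong +_ (#-pair y≢u))
    double-count : + n + (+ r - 1ℤ) ≡ + 3 * + r
    double-count = begin
      + n + (+ r - 1ℤ)                               ≡⟨ cong₂ _+_ (∑-one n) (∑-point u (+ r - 1ℤ)) ⟨
      ∑ {n} (λ _ → 1ℤ) + ∑ (point u (+ r - 1ℤ))      ≡⟨ ∑-+ (λ _ → 1ℤ) (point u (+ r - 1ℤ)) ⟨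
      ∑ (λ y → 1ℤ + point u (+ r - 1ℤ) y)            ≡⟨ ∑-cong load-σ ⟨
      ∑ (load S σ)                                   ≡⟨ ∑-load S (proj₁ sts) σ ⟩
      + 3 * ∑ σ                                      ≡⟨ cong (λ z → + 3 * z) (∑-# (I u)) ⟩
      + 3 * + r                                      ∎

  -- The blocks `tX` = {o, x, a}, `tY` and `tZ` join `o` to the three points of `t⋆` = {x, y, z},
  -- which misses `o`. Since `t⋆` shifts the load at x, y and z, these three blocks need prescribed
  -- symmetric weights to keep the loads there nonzero and small.
  record Frame : Set where
    field
      o x y z a     : Fin n
      tX tY tZ t⋆   : Fin (length S)
      o≢x           : o ≢ x
      a≢o           : a ≢ o
      a≢x           : a ≢ x
      o∈X           : I o tX ≡ true
      x∈X           : I x tX ≡ true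
      a∈X           : I a tX ≡ true
      X-points      : ∀ p → I p tX ≡ true → p ≡ o ⊎ p ≡ x ⊎ p ≡ a
      o∈Y           : I o tY ≡ true
      y∈Y           : I y tY ≡ true
      o∈Z           : I o tZ ≡ true
      z∈Z           : I z tZ ≡ true
      x∈⋆           : I x t⋆ ≡ true
      y∈⋆           : I y t⋆ ≡ true
      z∈⋆           : I z t⋆ ≡ true
      ⋆-points      : ∀ p → I p t⋆ ≡ true → p ≡ x ⊎ p ≡ y ⊎ p ≡ z
      o∉⋆           : I o t⋆ ≡ false
      Y≢X           : tY ≢ tX
      Z≢X           : tZ ≢ tX
      Z≢Y           : tZ ≢ tY

  -- With `o` and `x` both on `t′`, uniqueness of the joining block would force `t′` = `t` and put
  -- `y` on `t`.
  off-line : ∀ {o x y t t′} → o ≢ x → I o t ≡ true → I x t ≡ true → I y t ≢ true →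
    I x t′ ≡ true → I y t′ ≡ true → I o t′ ≢ true
  off-line {y = y} o≢x o∈t x∈t y∉t x∈t′ y∈t′ o∈t′ =
    y∉t (subst (λ t → I y t ≡ true) (meet-unique o≢x o∈t′ x∈t′ o∈t x∈t) y∈t′)

  -- `t⋆` is the block joining `x` and `y`, and `z` is its third point. Any coincidence among `tX`,
  -- `tY`, `tZ` would put `y` on `tX` or `o` on `t⋆`.
  complete-frame : ∀ {o x a tX} → o ≢ x → a ≢ o → a ≢ x →
    I o tX ≡ true → I x tX ≡ true → I a tX ≡ true →
    (∀ p → I p tX ≡ true → p ≡ o ⊎ p ≡ x ⊎ p ≡ a) →
    ∀ {y} → y ≢ o → y ≢ x → I y tX ≢ true → Frame
  complete-frame {o} {x} {a} {tX} o≢x a≢o a≢x o∈X x∈X a∈X X-points {y} y≢o y≢x y∉X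
    with line (y≢x ∘ sym) | line (y≢o ∘ sym)
  ... | t⋆ , x∈⋆ , y∈⋆ , _ | tY , o∈Y , y∈Y , _
    with third (lookup S t⋆) (distinct-blocks t⋆) x∈⋆ y∈⋆ (y≢x ∘ sym)
       | off-line {y = y} o≢x o∈X x∈X y∉X x∈⋆ y∈⋆
  ... | z , z∈⋆ , z≢x , z≢y , ⋆-points | o∉⋆ with line {o} {z} (λ { refl → o∉⋆ z∈⋆ })
  ... | tZ , o∈Z , z∈Z , _ = record
    { o = o ; x = x ; y = y ; z = z ; a = a ; tX = tX ; tY = tY ; tZ = tZ ; t⋆ = t⋆
    ; o≢x = o≢x ; a≢o = a≢o ; a≢x = a≢x
    ; o∈X = o∈X ; x∈X = x∈X ; a∈X = a∈X ; X-points = X-points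
    ; o∈Y = o∈Y ; y∈Y = y∈Y ; o∈Z = o∈Z ; z∈Z = z∈Z
    ; x∈⋆ = x∈⋆ ; y∈⋆ = y∈⋆ ; z∈⋆ = z∈⋆ ; ⋆-points = ⋆-points ; o∉⋆ = Bool.¬-not o∉⋆
    ; Y≢X = λ { refl → y∉X y∈Y }
    ; Z≢X = λ { refl → y∉X (subst (λ t → I y t ≡ true) (meet-unique z≢x z∈⋆ x∈⋆ z∈Z x∈X) y∈⋆) }
    ; Z≢Y = λ { refl → o∉⋆ (subst (λ t → I o t ≡ true) (meet-unique z≢y z∈Z y∈Y z∈⋆ y∈⋆) o∈Z) }
    }

  -- The block joining `o` and `x` has only one further point `a`, so one of the two candidates
  -- `y₁`, `y₂` lies off it.
  frame : ∀ {o x y₁ y₂} → o ≢ x → y₁ ≢ o → y₁ ≢ x → y₂ ≢ o → y₂ ≢ x → y₁ ≢ y₂ → Frame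
  frame {o} {x} {y₁} {y₂} o≢x y₁≢o y₁≢x y₂≢o y₂≢x y₁≢y₂ with line o≢x
  ... | tX , o∈X , x∈X , _ with third (lookup S tX) (distinct-blocks tX) o∈X x∈X o≢x
  ... | a , a∈X , a≢o , a≢x , X-points with y₁ ≟ a
  ... | no y₁≢a = complete-frame o≢x a≢o a≢x o∈X x∈X a∈X X-points y₁≢o y₁≢x
    λ y₁∈X → [ y₁≢o , [ y₁≢x , y₁≢a ]′ ]′ (X-points y₁ y₁∈X)
  ... | yes y₁≡a = complete-frame o≢x a≢o a≢x o∈X x∈X a∈X X-points y₂≢o y₂≢x
    λ y₂∈X → [ y₂≢o , [ y₂≢x , (λ y₂≡a → y₁≢y₂ (trans y₁≡a (sym y₂≡a))) ]′ ]′ (X-points y₂ y₂∈X)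

  -- Marked points; the flag `even` stands for an even replication number.

  module Design (frm : Frame) (even : Bool) where
    open Frame frm

    ⋆≢ : ∀ {t} → I o t ≡ true → t ≢ t⋆
    ⋆≢ o∈t refl = T≢F o∈t o∉⋆

    -- The blocks through `o` whose symmetric weight is 1 or -1 with a sign still to be chosen.
    free : Fin (length S) → Bool
    free = ((I o ∖ tX) ∖ tY) ∖ tZ

    #-free : # (I o) ≡ 3 ℕ.+ # free
    #-free = trans (#-∖ (I o) tX o∈X) (cong suc
      (trans (#-∖ (I o ∖ tX) tY (trans (∖-≢ (I o) Y≢X) o∈Y)) (cong suc
      (#-∖ ((I o ∖ tX) ∖ tY) tZ (trans (∖-≢ (I o ∖ tX) Z≢Y) (trans (∖-≢ (I o) Z≢X) o∈Z))))))

    -- The # free signs have sum - c, so c must have the parity of # free = (n - 1) / 2 - 3.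
    c : ℤ
    c = if even then -1ℤ else + 2

    -- The only point of `tX` with a skew weight there. In the even case `x` goes without one on
    -- both `t⋆` and `tX`; in the odd case `x` goes without one on `t⋆` only. Either way an even
    -- number of blocks remains at `x`.
    hub : Fin n
    hub = if even then a else x

    -- A point u of the block t has a nonzero skew weight in t iff mark t u.
    mark : Fin (length S) → Fin n → Bool
    mark t u =
      if ⌊ t ≟ t⋆ ⌋ then not ⌊ u ≟ x ⌋
      else if ⌊ t ≟ tX ⌋ then ⌊ u ≟ hub ⌋
      else if I o t then even ∧ not ⌊ u ≟ o ⌋
      else true

    E : Fin n → Fin (length S) → Bool
    E u t = I u t ∧ mark t u

    mark-⋆ : ∀ u → mark t⋆ u ≡ not ⌊ u ≟ x ⌋
    mark-⋆ u rewrite ⌊⌋-true (t⋆ ≟ t⋆) refl = refl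

    mark-X : ∀ u → mark tX u ≡ ⌊ u ≟ hub ⌋
    mark-X u rewrite ⌊⌋-false (tX ≟ t⋆) (⋆≢ o∈X) | ⌊⌋-true (tX ≟ tX) refl = refl

    mark-star : ∀ {t} u → t ≢ tX → I o t ≡ true → mark t u ≡ even ∧ not ⌊ u ≟ o ⌋
    mark-star {t} u t≢X o∈t
      rewrite ⌊⌋-false (t ≟ t⋆) (⋆≢ o∈t) | ⌊⌋-false (t ≟ tX) t≢X | o∈t = refl

    mark-off : ∀ {t} u → t ≢ t⋆ → I o t ≡ false → mark t u ≡ true
    mark-off {t} u t≢⋆ o∉t
      rewrite ⌊⌋-false (t ≟ t⋆) t≢⋆ | ⌊⌋-false (t ≟ tX) (λ { refl → T≢F o∈X o∉t }) | o∉t = refl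

    -- `tY` and `tZ` count as `star`: they differ from the free blocks only in their symmetric
    -- weight.
    data Kind (t : Fin (length S)) : Set where
      transversal : t ≡ t⋆ → Kind t
      axis        : t ≡ tX → Kind t
      star        : t ≢ tX → I o t ≡ true → Kind t
      off         : t ≢ t⋆ → I o t ≡ false → Kind t

    kind : ∀ t → Kind t
    kind t with t ≟ t⋆ | t ≟ tX | I o t in e
    ... | yes t≡⋆ | _       | _     = transversal t≡⋆
    ... | no _    | yes t≡X | _     = axis t≡X
    ... | no _    | no t≢X  | true  = star t≢X e
    ... | no t≢⋆  | no _    | false = off t≢⋆ e

    x≢o : x ≢ o
    x≢o = o≢x ∘ sym

    hub≢o : hub ≢ o
    hub≢o = avoid even
      where
      avoid : ∀ b → (if b then a else x) ≢ o
      avoid true  = a≢o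
      avoid false = x≢o

    hub∈X : I hub tX ≡ true
    hub∈X = go even
      where
      go : ∀ b → I (if b then a else x) tX ≡ true
      go true  = a∈X
      go false = x∈X

    E-o : ∀ t → E o t ≡ false
    E-o t with kind t
    ... | transversal refl rewrite o∉⋆ = refl
    ... | axis refl rewrite mark-X o | ⌊⌋-false (o ≟ hub) (hub≢o ∘ sym) = Bool.∧-zeroʳ _
    ... | star t≢X o∈t rewrite mark-star o t≢X o∈t | ⌊⌋-true (o ≟ o) refl | Bool.∧-zeroʳ even = Bool.∧-zeroʳ _
    ... | off t≢⋆ o∉t rewrite o∉t = refl

    tally-E : ∀ t {g} → (∀ u → mark t u ≡ g u) → tally (λ u → E u t) (lookup S t) ≡ tally g (lookup S t)
    tally-E t {g} m≡g = tally-cong (lookup S t) λ u u∈t → trans (cong (_∧ mark t u) u∈t) (m≡g u)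

    -- In the even case the two points other than `o` are marked, giving the pair (1, 2). In the odd
    -- case no point is marked, which leaves room for the weight 2 on `tY`.
    tally-star : ∀ {t} h → I o t ≡ true → h ≡ 1 ⊎ (even ≡ false × h ≡ 2) →
      T (admissible h (tally (λ u → even ∧ not ⌊ u ≟ o ⌋) (lookup S t)))
    tally-star {t} h o∈t = go even
      where
      go : ∀ b → h ≡ 1 ⊎ (b ≡ false × h ≡ 2) → T (admissible h (tally (λ u → b ∧ not ⌊ u ≟ o ⌋) (lookup S t)))
      go true  (inj₁ refl) rewrite proj₂ (tally-point (lookup S t) o (distinct-blocks t) o∈t) = tt
      go false (inj₁ refl) = tt
      go false (inj₂ (_ , refl)) = tt

    -- Symmetric weights and their loads.

    module Symmetric (f : Fin (length S) → ℤ) (∣f∣ : ∀ t → ∣ f t ∣ ≡ ⟦ free t ⟧) (∑f : ∑ f ≡ - c) where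

      -- The four prescribed values add up to `c`, which the sum of `f` offsets.
      s : Fin (length S) → ℤ
      s t =
        if ⌊ t ≟ t⋆ ⌋ then -1ℤ
        else if ⌊ t ≟ tX ⌋ then + 2
        else if ⌊ t ≟ tY ⌋ then c
        else if ⌊ t ≟ tZ ⌋ then -1ℤ
        else f t

      s-⋆ : s t⋆ ≡ -1ℤ
      s-⋆ rewrite ⌊⌋-true (t⋆ ≟ t⋆) refl = refl

      s-X : s tX ≡ + 2
      s-X rewrite ⌊⌋-false (tX ≟ t⋆) (⋆≢ o∈X) | ⌊⌋-true (tX ≟ tX) refl = refl

      s-Y : s tY ≡ c
      s-Y rewrite ⌊⌋-false (tY ≟ t⋆) (⋆≢ o∈Y) | ⌊⌋-false (tY ≟ tX) Y≢X | ⌊⌋-true (tY ≟ tY) refl = refl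

      s-Z : s tZ ≡ -1ℤ
      s-Z rewrite ⌊⌋-false (tZ ≟ t⋆) (⋆≢ o∈Z) | ⌊⌋-false (tZ ≟ tX) Z≢X | ⌊⌋-false (tZ ≟ tY) Z≢Y
        | ⌊⌋-true (tZ ≟ tZ) refl = refl

      s-else : ∀ {t} → t ≢ t⋆ → t ≢ tX → t ≢ tY → t ≢ tZ → s t ≡ f t
      s-else {t} ≢⋆ ≢X ≢Y ≢Z rewrite ⌊⌋-false (t ≟ t⋆) ≢⋆ | ⌊⌋-false (t ≟ tX) ≢X
        | ⌊⌋-false (t ≟ tY) ≢Y | ⌊⌋-false (t ≟ tZ) ≢Z = refl

      f≡0 : ∀ {t} → free t ≡ false → f t ≡ 0ℤ
      f≡0 {t} t∉ = ℤ.∣i∣≡0⇒i≡0 (trans (∣f∣ t) (cong ⟦_⟧ t∉))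

      f-off : ∀ {t} → I o t ≡ false → f t ≡ 0ℤ
      f-off {t} o∉t = f≡0 eq
        where
        eq : free t ≡ false
        eq rewrite o∉t = refl

      f-X : f tX ≡ 0ℤ
      f-X = f≡0 (trans (∖-≢ ((I o ∖ tX) ∖ tY) (Z≢X ∘ sym)) (trans (∖-≢ (I o ∖ tX) (Y≢X ∘ sym)) (∖-≡ (I o) {a = tX} refl)))

      f-Y : f tY ≡ 0ℤ
      f-Y = f≡0 (trans (∖-≢ ((I o ∖ tX) ∖ tY) (Z≢Y ∘ sym)) (∖-≡ (I o ∖ tX) {a = tY} refl))

      f-Z : f tZ ≡ 0ℤ
      f-Z = f≡0 (∖-≡ ((I o ∖ tX) ∖ tY) {a = tZ} refl)

      s-off : ∀ {t} → t ≢ t⋆ → I o t ≡ false → s t ≡ 0ℤ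
      s-off {t} t≢⋆ o∉t = trans (s-else t≢⋆ (avoid o∈X) (avoid o∈Y) (avoid o∈Z)) (f-off o∉t)
        where
        avoid : ∀ {t′} → I o t′ ≡ true → t ≢ t′
        avoid o∈t′ refl = T≢F o∈t′ o∉t

      s-star : ∀ {t} → t ≢ tX → I o t ≡ true → ∣ s t ∣ ≡ 1 ⊎ (even ≡ false × ∣ s t ∣ ≡ 2)
      s-star {t} t≢X o∈t = cases (t ≟ tY) (t ≟ tZ)
        where
        value-Y : ∀ b → let i = if b then -1ℤ else + 2 in ∣ i ∣ ≡ 1 ⊎ (b ≡ false × ∣ i ∣ ≡ 2)
        value-Y true  = inj₁ refl
        value-Y false = inj₂ (refl , refl)
        cases : Dec (t ≡ tY) → Dec (t ≡ tZ) → ∣ s t ∣ ≡ 1 ⊎ (even ≡ false × ∣ s t ∣ ≡ 2)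
        cases (yes refl) _          = subst (λ i → ∣ i ∣ ≡ 1 ⊎ (even ≡ false × ∣ i ∣ ≡ 2)) (sym s-Y) (value-Y even)
        cases (no _)     (yes refl) = inj₁ (cong ∣_∣ s-Z)
        cases (no t≢Y)   (no t≢Z)   = inj₁ (trans (cong ∣_∣ (s-else (⋆≢ o∈t) t≢X t≢Y t≢Z)) (trans (∣f∣ t)
          (cong ⟦_⟧ (trans (∖-≢ ((I o ∖ tX) ∖ tY) t≢Z) (trans (∖-≢ (I o ∖ tX) t≢Y) (trans (∖-≢ (I o) t≢X) o∈t))))))

      s-split : ∀ t → s t ≡ f t + (point t⋆ -1ℤ t + (point tX (+ 2) t + (point tY c t + point tZ -1ℤ t)))
      s-split t with t ≟ t⋆
      ... | yes refl rewrite f-off o∉⋆ | point-≢ (+ 2) (⋆≢ o∈X ∘ sym) | point-≢ c (⋆≢ o∈Y ∘ sym)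
        | point-≢ -1ℤ (⋆≢ o∈Z ∘ sym) = refl
      ... | no _ with t ≟ tX
      ...   | yes refl rewrite f-X | point-≢ c (Y≢X ∘ sym) | point-≢ -1ℤ (Z≢X ∘ sym) = refl
      ...   | no _ with t ≟ tY
      ...     | yes refl rewrite f-Y | point-≢ -1ℤ (Z≢Y ∘ sym) = identity c
        where
        identity : ∀ c → c ≡ 0ℤ + (0ℤ + (0ℤ + (c + 0ℤ)))
        identity = solve-∀
      ...     | no _ with t ≟ tZ
      ...       | yes refl rewrite f-Z = refl
      ...       | no _ = sym (ℤ.+-identityʳ _)

      ∑s : ∑ s ≡ 0ℤ
      ∑s = begin
        ∑ s                                                    ≡⟨ ∑-cong s-split ⟩
        ∑ (λ t → f t + (p⋆ t + (pX t + (pY t + pZ t))))        ≡⟨ ∑-+ f _ ⟩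
        ∑ f + ∑ (λ t → p⋆ t + (pX t + (pY t + pZ t)))          ≡⟨ cong₂ _+_ ∑f (trans (∑-+ p⋆ _)
          (cong₂ _+_ (∑-point t⋆ -1ℤ) (trans (∑-+ pX _) (cong₂ _+_ (∑-point tX (+ 2))
          (trans (∑-+ pY pZ) (cong₂ _+_ (∑-point tY c) (∑-point tZ -1ℤ))))))) ⟩
        - c + (-1ℤ + (+ 2 + (c + -1ℤ)))                        ≡⟨ identity c ⟩
        0ℤ                                                     ∎
        where
        open ≡-Reasoning
        p⋆ = point t⋆ -1ℤ
        pX = point tX (+ 2)
        pY = point tY c
        pZ = point tZ -1ℤ
        identity : ∀ c → - c + (-1ℤ + (+ 2 + (c + -1ℤ))) ≡ 0ℤ
        identity = solve-∀

      -- The pairs are (1, 2) on `t⋆`, (2, 1) on `tX`, those of `tally-star` on the other blocks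
      -- through `o`, and (0, 3) on all remaining blocks.
      admissible-E : ∀ t → T (admissible ∣ s t ∣ (tally (λ u → E u t) (lookup S t)))
      admissible-E t with kind t
      ... | transversal refl rewrite s-⋆ | tally-E t⋆ mark-⋆ | proj₂ (tally-point (lookup S t⋆) x (distinct-blocks t⋆) x∈⋆) = tt
      ... | axis refl rewrite s-X | tally-E tX mark-X | proj₁ (tally-point (lookup S tX) hub (distinct-blocks tX) hub∈X) = tt
      ... | star t≢X o∈t rewrite tally-E t (λ u → mark-star u t≢X o∈t) = tally-star ∣ s t ∣ o∈t (s-star t≢X o∈t)
      ... | off t≢⋆ o∉t rewrite s-off t≢⋆ o∉t | tally-E t (λ u → mark-off u t≢⋆ o∉t) = tt

      Small : ℤ → Set
      Small i = 1 ≤ ∣ i ∣ × ∣ i ∣ ≤ 2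

      -- Apart from `t⋆`, only blocks through `o` carry symmetric weight. The total is 0, and
      -- omitting the -1 on `t⋆` leaves 1.
      load-o : load S s o ≡ 1ℤ
      load-o = trans (∑-cong split) (trans (∑-+ s (point t⋆ 1ℤ)) (cong₂ _+_ ∑s (∑-point t⋆ 1ℤ)))
        where
        split : ∀ t → (if I o t then s t else 0ℤ) ≡ s t + point t⋆ 1ℤ t
        split t = cases (t ≟ t⋆) (I o t) refl
          where
          cases : Dec (t ≡ t⋆) → ∀ b → I o t ≡ b → (if b then s t else 0ℤ) ≡ s t + point t⋆ 1ℤ t
          cases (yes refl) true  e = contradiction o∉⋆ (T≢F e)
          cases (yes refl) false e = sym (cong₂ _+_ s-⋆ (point-≡ t⋆ 1ℤ))
          cases (no t≢⋆)   true  e = sym (trans (cong (λ i → s t + i) (point-≢ 1ℤ t≢⋆)) (ℤ.+-identityʳ _))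
          cases (no t≢⋆)   false e = sym (cong₂ _+_ (s-off t≢⋆ e) (point-≢ 1ℤ t≢⋆))

      -- Any further block through `u` misses `o`, since `tᵤ` is the only block joining the two;
      -- being different from `t⋆`, it has symmetric weight 0.
      load-outside : ∀ u {tᵤ} → I o tᵤ ≡ true → I u tᵤ ≡ true → u ≢ o → ∀ t → t ≢ tᵤ → t ≢ t⋆ →
        (if I u t then s t else 0ℤ) ≡ 0ℤ
      load-outside u o∈tᵤ u∈tᵤ u≢o t t≢tᵤ t≢⋆ with I u t in u∈t | I o t in o∈t
      ... | false | _     = refl
      ... | true  | false = s-off t≢⋆ o∈t
      ... | true  | true  = contradiction (meet-unique u≢o u∈t o∈t u∈tᵤ o∈tᵤ) t≢tᵤ

      load-on-⋆ : ∀ {u tᵤ} → I o tᵤ ≡ true → I u tᵤ ≡ true → u ≢ o → I u t⋆ ≡ true →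
        load S s u ≡ s tᵤ + -1ℤ
      load-on-⋆ {u} {tᵤ} o∈tᵤ u∈tᵤ u≢o u∈⋆ = trans
        (∑-supported₂ tᵤ t⋆ (λ t → if I u t then s t else 0ℤ) (⋆≢ o∈tᵤ) (load-outside u o∈tᵤ u∈tᵤ u≢o))
        (cong₂ _+_ (at u∈tᵤ) (trans (at u∈⋆) s-⋆))
        where
        at : ∀ {t} → I u t ≡ true → (if I u t then s t else 0ℤ) ≡ s t
        at u∈t rewrite u∈t = refl

      load-off-⋆ : ∀ {u tᵤ} → I o tᵤ ≡ true → I u tᵤ ≡ true → u ≢ o → I u t⋆ ≡ false →
        load S s u ≡ s tᵤ
      load-off-⋆ {u} {tᵤ} o∈tᵤ u∈tᵤ u≢o u∉⋆ = trans
        (∑-supported tᵤ (λ t → if I u t then s t else 0ℤ) outside)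
        at
        where
        at : (if I u tᵤ then s tᵤ else 0ℤ) ≡ s tᵤ
        at rewrite u∈tᵤ = refl
        outside : ∀ t → t ≢ tᵤ → (if I u t then s t else 0ℤ) ≡ 0ℤ
        outside t t≢tᵤ = cases (t ≟ t⋆)
          where
          cases : Dec (t ≡ t⋆) → (if I u t then s t else 0ℤ) ≡ 0ℤ
          cases (yes refl) rewrite u∉⋆ = refl
          cases (no t≢⋆)   = load-outside u o∈tᵤ u∈tᵤ u≢o t t≢tᵤ t≢⋆

      s-small : ∀ {t} → I o t ≡ true → Small (s t)
      s-small {t} o∈t = cases (t ≟ tX)
        where
        cases : Dec (t ≡ tX) → Small (s t)
        cases (yes refl) rewrite s-X = s≤s z≤n , s≤s (s≤s z≤n)
        cases (no t≢X) with s-star t≢X o∈t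
        ... | inj₁ e       rewrite e = s≤s z≤n , s≤s z≤n
        ... | inj₂ (_ , e) rewrite e = s≤s z≤n , s≤s (s≤s z≤n)

      -- The load is 1 at `o`, 2 - 1 at `x`, `c` - 1 (that is, -2 or 1) at `y`, and -1 - 1 at `z`.
      -- Any other point has the weight of the block joining it to `o`.
      load-small : ∀ u → Small (load S s u)
      load-small u with u ≟ o
      ... | yes refl rewrite load-o = s≤s z≤n , s≤s z≤n
      ... | no u≢o with I u t⋆ in u∈⋆
      ...   | true with ⋆-points u u∈⋆
      ...     | inj₁ refl rewrite load-on-⋆ o∈X x∈X u≢o u∈⋆ | s-X = s≤s z≤n , s≤s z≤n
      ...     | inj₂ (inj₂ refl) rewrite load-on-⋆ o∈Z z∈Z u≢o u∈⋆ | s-Z = s≤s z≤n , s≤s (s≤s z≤n)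
      ...     | inj₂ (inj₁ refl) rewrite load-on-⋆ o∈Y y∈Y u≢o u∈⋆ | s-Y = go even
        where
        go : ∀ b → Small ((if b then -1ℤ else + 2) + -1ℤ)
        go true  = s≤s z≤n , s≤s (s≤s z≤n)
        go false = s≤s z≤n , s≤s z≤n
      load-small u | no u≢o | false with line (u≢o ∘ sym)
      ... | tᵤ , o∈tᵤ , u∈tᵤ , _ = subst Small (sym (load-off-⋆ o∈tᵤ u∈tᵤ u≢o u∈⋆)) (s-small o∈tᵤ)

  -- Parity of the number of skew weights at each point.

  module _ (frm : Frame) where
    open Frame frm
    open Design frm using (⋆≢; mark; mark-⋆; mark-X; mark-star; mark-off; kind; transversal; axis; star; off)

    -- Only `tX` needs an argument: a point on it other than `o` and `x` is `a`, the hub in the even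
    -- case.
    E-even : ∀ u → u ≢ o → u ≢ x → ∀ t → Design.E frm true u t ≡ I u t
    E-even u u≢o u≢x t with kind true t
    ... | transversal refl rewrite mark-⋆ true u | ⌊⌋-false (u ≟ x) u≢x = Bool.∧-identityʳ _
    ... | axis refl rewrite mark-X true u with I u tX in u∈X
    ...   | false = refl
    ...   | true = [ (λ e → contradiction e u≢o) , [ (λ e → contradiction e u≢x) , ⌊⌋-true (u ≟ a) ]′ ]′ (X-points u u∈X)
    E-even u u≢o u≢x t | star t≢X o∈t rewrite mark-star true u t≢X o∈t | ⌊⌋-false (u ≟ o) u≢o = Bool.∧-identityʳ _
    E-even u u≢o u≢x t | off t≢⋆ o∉t rewrite mark-off true u t≢⋆ o∉t = Bool.∧-identityʳ _

    x∉star : ∀ {t} → t ≢ tX → I o t ≡ true → I x t ≡ false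
    x∉star t≢X o∈t = Bool.¬-not λ x∈t → t≢X (meet-unique o≢x o∈t x∈t o∈X x∈X)

    X≢off : ∀ {t} → I o t ≡ false → t ≢ tX
    X≢off o∉t refl = T≢F o∈X o∉t

    E-even-x : ∀ t → Design.E frm true x t ≡ ((I x ∖ t⋆) ∖ tX) t
    E-even-x t with kind true t
    ... | transversal refl rewrite mark-⋆ true x | ⌊⌋-true (x ≟ x) refl | Bool.∧-zeroʳ (I x t⋆)
      | ∖-≡ (I x) {a = t⋆} refl = refl
    ... | axis refl rewrite mark-X true x | ⌊⌋-false (x ≟ a) (a≢x ∘ sym) =
      trans (Bool.∧-zeroʳ _) (sym (∖-≡ (I x ∖ t⋆) {a = tX} refl))
    ... | star t≢X o∈t rewrite x∉star t≢X o∈t = refl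
    ... | off t≢⋆ o∉t rewrite mark-off true x t≢⋆ o∉t = trans (Bool.∧-identityʳ _)
      (sym (trans (∖-≢ (I x ∖ t⋆) (X≢off o∉t)) (∖-≢ (I x) t≢⋆)))

    star-∖ : ∀ {u tᵤ t} → u ≢ o → I o tᵤ ≡ true → I u tᵤ ≡ true → I o t ≡ true → (I u ∖ tᵤ) t ≡ false
    star-∖ {u} {tᵤ} {t} u≢o o∈tᵤ u∈tᵤ o∈t = cases (I u t) refl
      where
      cases : ∀ b → I u t ≡ b → (I u ∖ tᵤ) t ≡ false
      cases true  u∈t = ∖-≡ (I u) (meet-unique u≢o u∈t o∈t u∈tᵤ o∈tᵤ)
      cases false u∉t = cong (_∧ not ⌊ t ≟ tᵤ ⌋) u∉t

    -- In the odd case the blocks through `o` mark no point but `x`, so `u` loses exactly the block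
    -- joining it to `o`.
    E-odd : ∀ u → u ≢ o → u ≢ x → ∀ {tᵤ} → I o tᵤ ≡ true → I u tᵤ ≡ true →
      ∀ t → Design.E frm false u t ≡ (I u ∖ tᵤ) t
    E-odd u u≢o u≢x {tᵤ} o∈tᵤ u∈tᵤ t with kind false t
    ... | transversal refl rewrite mark-⋆ false u | ⌊⌋-false (u ≟ x) u≢x =
      trans (Bool.∧-identityʳ _) (sym (∖-≢ (I u) (⋆≢ false o∈tᵤ ∘ sym)))
    ... | axis refl rewrite mark-X false u | ⌊⌋-false (u ≟ x) u≢x =
      trans (Bool.∧-zeroʳ _) (sym (star-∖ u≢o o∈tᵤ u∈tᵤ o∈X))
    ... | star t≢X o∈t rewrite mark-star false u t≢X o∈t = trans (Bool.∧-zeroʳ _) (sym (star-∖ u≢o o∈tᵤ u∈tᵤ o∈t))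
    ... | off t≢⋆ o∉t rewrite mark-off false u t≢⋆ o∉t = trans (Bool.∧-identityʳ _)
      (sym (∖-≢ (I u) λ { refl → T≢F o∈tᵤ o∉t }))

    -- As the hub, `x` keeps its mark on `tX`, the block joining it to `o`, and loses `t⋆` instead.
    E-odd-x : ∀ t → Design.E frm false x t ≡ (I x ∖ t⋆) t
    E-odd-x t with kind false t
    ... | transversal refl rewrite mark-⋆ false x | ⌊⌋-true (x ≟ x) refl =
      trans (Bool.∧-zeroʳ _) (sym (∖-≡ (I x) {a = t⋆} refl))
    ... | axis refl rewrite mark-X false x | ⌊⌋-true (x ≟ x) refl =
      trans (Bool.∧-identityʳ _) (sym (∖-≢ (I x) (⋆≢ false o∈X)))
    ... | star t≢X o∈t rewrite x∉star t≢X o∈t = refl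
    ... | off t≢⋆ o∉t rewrite mark-off false x t≢⋆ o∉t = trans (Bool.∧-identityʳ _) (sym (∖-≢ (I x) t≢⋆))

    #-E-o : ∀ b → # (Design.E frm b o) ≡ 0
    #-E-o b = trans (#-cong (Design.E-o frm b)) (#-false (length S))
      where
      #-false : ∀ m → # {m} (λ _ → false) ≡ 0
      #-false zero    = refl
      #-false (suc m) = #-false m

    -- With replication number r = 4 + 2g the counts are 0 at `o`, r - 2 at `x` and r elsewhere.
    E-even-balanced : ∀ g → (∀ u → # (I u) ≡ (2 ℕ.+ g) ℕ.+ (2 ℕ.+ g)) →
      ∀ u → ∃[ k ] # (Design.E frm true u) ≡ k ℕ.+ k
    E-even-balanced g deg u = cases (u ≟ o) (u ≟ x)
      where
      open ≡-Reasoning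
      cases : Dec (u ≡ o) → Dec (u ≡ x) → ∃[ k ] # (Design.E frm true u) ≡ k ℕ.+ k
      cases (yes refl) _          = 0 , #-E-o true
      cases (no u≢o)   (no u≢x)   = 2 ℕ.+ g , trans (#-cong (E-even u u≢o u≢x)) (deg u)
      cases (no u≢o)   (yes refl) = suc g , trans (#-cong E-even-x)
        (ℕ.suc-injective (ℕ.suc-injective (begin
          2 ℕ.+ # ((I x ∖ t⋆) ∖ tX)     ≡⟨ cong suc (#-∖ (I x ∖ t⋆) tX (trans (∖-≢ (I x) (⋆≢ true o∈X)) x∈X)) ⟨
          1 ℕ.+ # (I x ∖ t⋆)            ≡⟨ #-∖ (I x) t⋆ x∈⋆ ⟨
          # (I x)                       ≡⟨ deg x ⟩
          2 ℕ.+ (g ℕ.+ (2 ℕ.+ g))       ≡⟨ cong (2 ℕ.+_) (ℕ.+-suc g (suc g)) ⟩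
          2 ℕ.+ (suc g ℕ.+ suc g)       ∎)))

    -- With replication number r = 1 + 2h the count is 0 at `o` and r - 1 at every other point.
    E-odd-balanced : ∀ h → (∀ u → # (I u) ≡ suc (h ℕ.+ h)) →
      ∀ u → ∃[ k ] # (Design.E frm false u) ≡ k ℕ.+ k
    E-odd-balanced h deg u = cases (u ≟ o) (u ≟ x)
      where
      cases : Dec (u ≡ o) → Dec (u ≡ x) → ∃[ k ] # (Design.E frm false u) ≡ k ℕ.+ k
      cases (yes refl) _          = 0 , #-E-o false
      cases (no u≢o)   (yes refl) = h , trans (#-cong E-odd-x)
        (ℕ.suc-injective (trans (sym (#-∖ (I x) t⋆ x∈⋆)) (deg x)))
      cases (no u≢o)   (no u≢x) with line (u≢o ∘ sym)
      ... | tᵤ , o∈tᵤ , u∈tᵤ , _ = h , trans (#-cong (E-odd u u≢o u≢x o∈tᵤ u∈tᵤ))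
        (ℕ.suc-injective (trans (sym (#-∖ (I u) tᵤ u∈tᵤ)) (deg u)))

    -- `signing` is used once for the free blocks and once at each point for the skew weights. The
    -- signs at different points can be chosen independently, because admissibility depends only on
    -- absolute values.
    design-flow : ∀ b → (∀ u → ∃[ k ] # (Design.E frm b u) ≡ k ℕ.+ k) →
      ∀ p q → # (Design.free frm b) ≡ p ℕ.+ q → + p - + q ≡ - Design.c frm b →
      ∀ τ → ZeroSum5Flow (suc (n ℕ.+ n)) (assmusMattson n S τ)
    design-flow b balanced p q #free p-q τ with signing (Design.free frm b) p q #free
    ... | f , ∣f∣ , ∑f = lifted-flow S (proj₁ sts) τ s skew
      (λ u t → subst (_≤ 1) (sym (∣skew∣ u t)) (⟦⟧≤1 (E u t)))
      skew-supported
      (λ u → trans (proj₂ (proj₂ (signs u))) (ℤ.+-inverseʳ (+ proj₁ (balanced u))))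
      admissible-skew load-small ∑s
      where
      open Design frm b using (E)
      open Design.Symmetric frm b f ∣f∣ (trans ∑f p-q)
      signs : ∀ u → ∃[ f ] (∀ t → ∣ f t ∣ ≡ ⟦ E u t ⟧) × ∑ f ≡ + proj₁ (balanced u) - + proj₁ (balanced u)
      signs u = signing (E u) (proj₁ (balanced u)) (proj₁ (balanced u)) (proj₂ (balanced u))
      skew : Fin n → Fin (length S) → ℤ
      skew u = proj₁ (signs u)
      ∣skew∣ : ∀ u t → ∣ skew u t ∣ ≡ ⟦ E u t ⟧
      ∣skew∣ u = proj₁ (proj₂ (signs u))
      ⟦⟧≤1 : ∀ b → ⟦ b ⟧ ≤ 1
      ⟦⟧≤1 true  = s≤s z≤n
      ⟦⟧≤1 false = z≤n
      skew-supported : ∀ u t → I u t ≡ false → skew u t ≡ 0ℤ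
      skew-supported u t u∉t = ℤ.∣i∣≡0⇒i≡0 (trans (∣skew∣ u t) (cong (λ i → ⟦ i ∧ mark b t u ⟧) u∉t))
      admissible-skew : ∀ t → let (i , j , k) = lookup S t in
        T (admissible ∣ s t ∣ (∣ skew i t ∣ ℕ.+ ∣ skew j t ∣ ℕ.+ ∣ skew k t ∣))
      admissible-skew t =
        let (i , j , k) = lookup S t in
        subst (λ h → T (admissible ∣ s t ∣ h))
          (sym (cong₂ ℕ._+_ (cong₂ ℕ._+_ (∣skew∣ i t) (∣skew∣ j t)) (∣skew∣ k t))) (admissible-E t)

  -- The flow for each parity of the replication number.

  module _ (frm : Frame) (g : ℕ) where
    open Frame frm

    even-flow : (∀ u → # (I u) ≡ (2 ℕ.+ g) ℕ.+ (2 ℕ.+ g)) →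
      ∀ τ → ZeroSum5Flow (suc (n ℕ.+ n)) (assmusMattson n S τ)
    -- There are r - 3 = 2g + 1 free blocks; g + 1 plus signs and g minus signs give the sum 1 = -c.
    even-flow deg = design-flow frm true (E-even-balanced frm g deg) (suc g) g
      (ℕ.+-cancelˡ-≡ 3 _ _ (begin
        3 ℕ.+ # (Design.free frm true)  ≡⟨ Design.#-free frm true ⟨
        # (I o)                         ≡⟨ deg o ⟩
        2 ℕ.+ (g ℕ.+ (2 ℕ.+ g))         ≡⟨ cong (2 ℕ.+_) (trans (ℕ.+-suc g (suc g)) (cong suc (ℕ.+-suc g g))) ⟩
        3 ℕ.+ (suc g ℕ.+ g)             ∎))
      (identity (+ g))
      where
      open ≡-Reasoning
      identity : ∀ g → (1ℤ + g) - g ≡ 1ℤ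
      identity = solve-∀

    odd-flow : (∀ u → # (I u) ≡ suc ((2 ℕ.+ g) ℕ.+ (2 ℕ.+ g))) →
      ∀ τ → ZeroSum5Flow (suc (n ℕ.+ n)) (assmusMattson n S τ)
    -- There are r - 3 = 2g + 2 free blocks; g plus signs and g + 2 minus signs give the sum -2 =
    -- -c.
    odd-flow deg = design-flow frm false (E-odd-balanced frm (2 ℕ.+ g) deg) g (2 ℕ.+ g)
      (ℕ.+-cancelˡ-≡ 3 _ _ (trans (sym (Design.#-free frm false)) (deg o)))
      (identity (+ g))
      where
      identity : ∀ g → g - (+ 2 + g) ≡ - (+ 2)
      identity = solve-∀

-- Case distinction on parity and small orders.

parity : ∀ r → ∃[ h ] (r ≡ h ℕ.+ h ⊎ r ≡ suc (h ℕ.+ h))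
parity zero    = 0 , inj₁ refl
parity (suc r) with parity r
... | h , inj₁ refl = h , inj₂ refl
... | h , inj₂ refl = suc h , inj₁ (cong suc (sym (ℕ.+-suc h h)))

theorem7 : (n : ℕ) (S : List (Block n)) → IsSTS n S →
    (τ : Fin (length S) → Bool) → 99 ≤ suc (n ℕ.+ n) →
    ZeroSum5Flow (suc (n ℕ.+ n)) (assmusMattson n S τ)
-- `frame` is started from four distinct points; for n below 4 the order is at most 7.
theorem7 0 S sts τ 99≤ = contradiction 99≤ (from-no (99 ℕ.≤? 1))
theorem7 1 S sts τ 99≤ = contradiction 99≤ (from-no (99 ℕ.≤? 3))
theorem7 2 S sts τ 99≤ = contradiction 99≤ (from-no (99 ℕ.≤? 5))
theorem7 3 S sts τ 99≤ = contradiction 99≤ (from-no (99 ℕ.≤? 7))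
theorem7 n@(suc (suc (suc (suc _)))) S sts τ 99≤ = by-parity (parity (# (I zero)))
  where
  open Geometry S sts
  frm : Frame
  frm = frame {o = zero} {x = suc zero} {y₁ = suc (suc zero)} {y₂ = suc (suc (suc zero))}
    (λ ()) (λ ()) (λ ()) (λ ()) (λ ()) (λ ())
  regular : ∀ u → # (I u) ≡ # (I zero)
  -- Halving n - 1 = 2r recovers r, so every point lies on equally many blocks.
  regular u = trans (ℕ.n≡⌊n+n/2⌋ _) (trans
    (cong ℕ.⌊_/2⌋ (ℕ.suc-injective (trans (sym (degree u)) (degree zero)))) (sym (ℕ.n≡⌊n+n/2⌋ _)))
  small : ∀ {r} → # (I zero) ≡ r → 99 ≤ suc (suc (r ℕ.+ r) ℕ.+ suc (r ℕ.+ r))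
  small refl = subst (λ n → 99 ≤ suc (n ℕ.+ n)) (degree zero) 99≤
  by-parity : ∃[ h ] (# (I zero) ≡ h ℕ.+ h ⊎ # (I zero) ≡ suc (h ℕ.+ h)) →
    ZeroSum5Flow (suc (n ℕ.+ n)) (assmusMattson n S τ)
  -- Replication number r gives order 4r + 3, so r = 0, 2, 1, 3 would mean order 3, 11, 7, 15.
  by-parity (0 , inj₁ e) = contradiction (small e) (from-no (99 ℕ.≤? 3))
  by-parity (1 , inj₁ e) = contradiction (small e) (from-no (99 ℕ.≤? 11))
  by-parity (0 , inj₂ e) = contradiction (small e) (from-no (99 ℕ.≤? 7))
  by-parity (1 , inj₂ e) = contradiction (small e) (from-no (99 ℕ.≤? 15))
  by-parity (suc (suc g) , inj₁ e) = even-flow frm g (λ u → trans (regular u) e) τ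
  by-parity (suc (suc g) , inj₂ e) = odd-flow frm g (λ u → trans (regular u) e) τ
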